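{- Let $G$ be a finite simple graph with $m:=|E(G)|$ and maximum degree $\Delta(G)\le \frac{m}{4350}$. Then $$\mathrm{tes}(G)=\left\lceil\frac{m+2}{3}\right\rceil.$$
   Context: Graphs are finite and simple. For a graph $G=(V,E)$ and a positive integer $s$, an edge irregular total $s$-weighting is a map $\hat w:E\cup V\to\{1,2,\ldots,s\}$ such that $\hat w(uv)+\hat w(u)+\hat w(v)\ne \hat w(u'v')+\hat w(u')+\hat w(v')$ whenever $uv\neq u'v'$ are two different edges of $G$. The total edge irregularity strength $\mathrm{tes}(G)$ is the minimum $s$ for which there exists an edge irregular total $s$-weighting of $G$. -}

module Defs where

open import Data.Fin using (Fin; _<_)
open import Data.Fin.Properties using (_<?_)
open import Data.List using (List; length; filter; map; allFin; cartesianProduct)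
open import Data.List.Extrema.Nat using (max)
open import Data.Nat using (ℕ; _+_; _≤_)
open import Data.Nat.Properties using (≤-antisym)
open import Data.Product using (Σ-syntax; _×_; _,_)
open import Data.Sum using (_⊎_; inj₁; inj₂)
open import Level using (0ℓ)
open import Relation.Binary using (Rel; Decidable; Symmetric; Irreflexive)
open import Relation.Binary.PropositionalEquality using (_≡_; _≢_)
open import Relation.Nullary.Decidable using (_×-dec_)

record Graph : Set₁ where
  field
    order      : ℕ
    Adj        : Rel (Fin order) 0ℓ
    adj?       : Decidable Adj
    adj-sym    : Symmetric Adj
    adj-irrefl : Irreflexive _≡_ Adj

  Vertex : Set
  Vertex = Fin order

  -- An unordered edge {u , v} is represented once, with its smaller endpoint
  -- first.  The proof fields are irrelevant, so two edges are equal exactly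
  -- when their endpoints are.
  record Edge : Set where
    constructor edge
    field
      src tgt    : Vertex
      .src<tgt   : src < tgt
      .adjacent  : Adj src tgt

  open Edge public using (src; tgt)

  edgePairs : List (Vertex × Vertex)
  edgePairs = filter (λ (u , v) → (u <? v) ×-dec adj? u v)
                     (cartesianProduct (allFin order) (allFin order))

  size : ℕ
  size = length edgePairs

  degree : Vertex → ℕ
  degree v = length (filter (adj? v) (allFin order))

  -- The graph without vertices gets maximum degree 0.
  maxDegree : ℕ
  maxDegree = max 0 (map degree (allFin order))

module _ (G : Graph) where
  open Graph G

  Weighting : Set
  Weighting = Edge ⊎ Vertex → ℕ

  edgeWeight : Weighting → Edge → ℕ
  edgeWeight w e = w (inj₁ e) + w (inj₂ (src e)) + w (inj₂ (tgt e))

  record IsEdgeIrregular (s : ℕ) (w : Weighting) : Set where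
    field
      positive  : ∀ x → 1 ≤ w x
      bounded   : ∀ x → w x ≤ s
      irregular : ∀ e f → e ≢ f → edgeWeight w e ≢ edgeWeight w f

  HasEdgeIrregularWeighting : ℕ → Set
  HasEdgeIrregularWeighting s = Σ[ w ∈ Weighting ] IsEdgeIrregular s w

  -- IsTes t says tes(G) = t.  Requiring s to be positive matters only for the
  -- graph without vertices, where s = 0 would otherwise qualify.
  record IsTes (t : ℕ) : Set where
    field
      positive : 1 ≤ t
      attained : HasEdgeIrregularWeighting t
      least    : ∀ s → 1 ≤ s → HasEdgeIrregularWeighting s → t ≤ s

  IsTes-unique : ∀ {t t′} → IsTes t → IsTes t′ → t ≡ t′
  IsTes-unique p q = ≤-antisym (P.least _ Q.positive Q.attained)
                               (Q.least _ P.positive P.attained)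
    where
    module P = IsTes p
    module Q = IsTes q

{-# OPTIONS --safe #-}
-- Subtract 1 from all labels and put s = ⌈(m-1)/3⌉.  Given vertex weights ω : V → [0, s], it suffices
-- to rank the edges 0, …, m-1 so that ω u + ω v ≤ rank (uv) ≤ ω u + ω v + s: the edge label is the
-- difference, and the edge weights are the ranks.
--
-- Put every vertex into one of 12 classes with levels 0,0,0,0,1,2,3,4,5,5,5,5, set ω = ⌊ level · s / 5 ⌋
-- and rank the edges by the sum of the levels of their ends.  The inequalities then only ask that the
-- number N j of edges with level sum at most j lie (up to rounding) between (j+1) s / 5 and (j+5) s / 5
-- for j < 10.  For uniformly random classes the expectation of N j is well inside this interval, and
-- since m ≥ 4350 Δ the sum of the ten variances is small enough for Chebyshev's inequality.  The random
-- choice is made constructive by the method of conditional expectations.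
module Submission where

open import Defs
open import Data.Bool using (true; false; if_then_else_)
open import Data.Fin as Fin using (Fin; zero; suc; toℕ; fromℕ<; combine)
open import Data.Fin.Properties
  using (all?; _<?_; toℕ-fromℕ<; toℕ<n; toℕ-injective; fromℕ<-injective; combine-injective; injective⇒≤)
import Data.Integer as ℤ
open import Data.Integer using (ℤ; 0ℤ; 1ℤ)
import Data.Integer.Properties as ℤ
import Data.Integer.Tactic.RingSolver as ℤRing
open import Data.List as List
  using (List; []; _∷_; _++_; length; filter; foldr; map; allFin; cartesianProduct; tabulate)
open import Data.List.Extrema.Nat using (xs≤max)
open import Data.List.Membership.Propositional using (_∈_)
open import Data.List.Membership.Propositional.Properties
  using (∈-allFin; ∈-map⁺; ∈-filter⁺; ∈-filter⁻; ∈-cartesianProduct⁺; ∈-lookup)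
open import Data.List.Properties using (map-tabulate; filter-notAll)
import Data.List.Relation.Unary.All as All
import Data.List.Relation.Unary.Any as Any
open import Data.List.Relation.Unary.Any using (here; there)
open import Data.List.Relation.Unary.AllPairs using (_∷_)
open import Data.List.Relation.Unary.Unique.Propositional using (Unique)
open import Data.List.Relation.Unary.Unique.Propositional.Properties
  using (filter⁺; cartesianProduct⁺; allFin⁺)
import Data.Nat as ℕ
open import Data.Nat using (ℕ; zero; suc; s≤s; z≤n)
open import Data.Nat.DivMod using (m≡m%n+[m/n]*n; m%n<n; m/n*n≤m; m*n/n≡m)
import Data.Nat.Properties as ℕ
import Data.Nat.Tactic.RingSolver as ℕRing
open import Data.Product using (∃-syntax; _×_; _,_; proj₁; proj₂)
import Data.Rational.Unnormalised as ℚ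
import Data.Rational.Unnormalised.Properties as ℚ
open import Data.Sum using (inj₁; inj₂)
open import Data.Vec as Vec using ([]; _∷_)
import Data.Vec.Functional as Vector
open import Function using (_∘_; id)
open import Level using (Level)
open import Relation.Binary using (tri<; tri≈; tri>)
open import Relation.Binary.PropositionalEquality hiding ([_])
open import Relation.Nullary using (¬_; Dec; does; yes; no; contradiction; _because_)
open import Relation.Nullary.Decidable using (from-yes; dec-false; recompute; _×-dec_)
open import Relation.Unary using (Pred; Decidable)

open import Algebra.Properties.Semiring.Sum ℤ.+-*-semiring
  using (sum; sum-syntax; sum-cong-≗; ∑-comm; ∑-distrib-+; *-distribˡ-sum; *-distribʳ-sum)
open import Data.Integer using (+_)

-- Finite sums of integers.

module Forms where

  open import Data.Integer using (_+_; _*_; _-_; -_)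

  ∑-mono : ∀ {n} {f g : Fin n → ℤ} → (∀ i → f i ℤ.≤ g i) → sum f ℤ.≤ sum g
  ∑-mono {zero}  f≤g = ℤ.≤-refl
  ∑-mono {suc n} f≤g = ℤ.+-mono-≤ (f≤g zero) (∑-mono (f≤g ∘ suc))

  ∑-zero : ∀ {n} {f : Fin n → ℤ} → (∀ i → f i ≡ 0ℤ) → sum f ≡ 0ℤ
  ∑-zero {zero}  f≡0 = refl
  ∑-zero {suc n} f≡0 = cong₂ _+_ (f≡0 zero) (∑-zero (f≡0 ∘ suc))

  ∑-const : ∀ n x → ∑[ i < n ] x ≡ + n * x
  ∑-const zero    x = refl
  ∑-const (suc n) x = trans (cong (_+_ x) (∑-const n x)) (sym (ℤ.suc-* (+ n) x))

  term≤∑ : ∀ {n} {f : Fin n → ℤ} → (∀ i → 0ℤ ℤ.≤ f i) → ∀ i → f i ℤ.≤ sum f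
  term≤∑ {suc n} {f} 0≤f zero =
    subst (ℤ._≤ sum f) (ℤ.+-identityʳ (f zero))
      (ℤ.+-monoʳ-≤ (f zero)
        (subst (ℤ._≤ sum (f ∘ suc)) (∑-zero {n} λ _ → refl) (∑-mono (0≤f ∘ suc))))
  term≤∑ {suc n} {f} 0≤f (suc i) =
    subst (ℤ._≤ sum f) (ℤ.+-identityˡ (f (suc i)))
      (ℤ.+-mono-≤ (0≤f zero) (term≤∑ (0≤f ∘ suc) i))

  -- The existence half of an averaging argument, made effective by a search: if the first term
  -- exceeds `b`, the remaining terms still have average at most `b`.
  some-term≤average : ∀ {n} (f : Fin (suc n) → ℤ) b →
                      sum f ℤ.≤ + suc n * b → ∃[ i ] f i ℤ.≤ b
  some-term≤average {n} f b ∑f≤ with f zero ℤ.≤? b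
  ... | yes f₀≤b = zero , f₀≤b
  some-term≤average {zero} f b ∑f≤ | no _ =
    zero , subst₂ ℤ._≤_ (ℤ.+-identityʳ _) (ℤ.*-identityˡ b) ∑f≤
  some-term≤average {suc n} f b ∑f≤ | no f₀≰b =
    let i , fᵢ≤b = some-term≤average (f ∘ suc) b (ℤ.≮⇒≥ λ nb<∑ →
          ℤ.<⇒≱ (ℤ.+-mono-< (ℤ.≰⇒> f₀≰b) nb<∑)
            (subst (sum f ℤ.≤_) (ℤ.suc-* (+ suc n) b) ∑f≤))
    in suc i , fᵢ≤b

  ∑∑ : ∀ {m n} → (Fin m → Fin n → ℤ) → ℤ
  ∑∑ f = sum (sum ∘ f)

  ∑∑-cong : ∀ {m n} {f g : Fin m → Fin n → ℤ} → (∀ i j → f i j ≡ g i j) → ∑∑ f ≡ ∑∑ g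
  ∑∑-cong f≡g = sum-cong-≗ (λ i → sum-cong-≗ (f≡g i))

  ∑∑-distrib-+ : ∀ {m n} (f g : Fin m → Fin n → ℤ) →
                 ∑∑ (λ i j → f i j + g i j) ≡ ∑∑ f + ∑∑ g
  ∑∑-distrib-+ f g =
    trans (sum-cong-≗ (λ i → ∑-distrib-+ (f i) (g i))) (∑-distrib-+ (sum ∘ f) (sum ∘ g))

  *-distribˡ-∑∑ : ∀ {m n} x (f : Fin m → Fin n → ℤ) →
                  x * ∑∑ f ≡ ∑∑ (λ i j → x * f i j)
  *-distribˡ-∑∑ x f =
    trans (*-distribˡ-sum x (sum ∘ f)) (sum-cong-≗ (λ i → *-distribˡ-sum x (f i)))

  -- Splitting off the first index matches the order in which the vertices receive their classes
  -- below, one at a time from `zero` on.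
  upperSum : ∀ {n} → (Fin n → Fin n → ℤ) → ℤ
  upperSum {zero}  f = 0ℤ
  upperSum {suc n} f = ∑[ v < n ] f zero (suc v) + upperSum (λ u v → f (suc u) (suc v))

  upperSum-cong : ∀ {n} {f g : Fin n → Fin n → ℤ} → (∀ u v → f u v ≡ g u v) → upperSum f ≡ upperSum g
  upperSum-cong {zero}  f≡g = refl
  upperSum-cong {suc n} f≡g = cong₂ _+_ (sum-cong-≗ (λ v → f≡g zero (suc v)))
                                        (upperSum-cong (λ u v → f≡g (suc u) (suc v)))

  ∑∑-upper : ∀ {n} {f : Fin n → Fin n → ℤ} → (∀ {u v} → toℕ v ℕ.≤ toℕ u → f u v ≡ 0ℤ) →
             ∑∑ f ≡ upperSum f
  ∑∑-upper {zero} f≡0 = refl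
  ∑∑-upper {suc n} {f} f≡0 = begin
    (f zero zero + r) + ∑[ u < n ] (f (suc u) zero + sum (f (suc u) ∘ suc))
      ≡⟨ cong₂ _+_ (trans (cong (_+ r) (f≡0 {zero} {zero} ℕ.z≤n)) (ℤ.+-identityˡ r))
           (sum-cong-≗ λ u → trans (cong (_+ sum (f (suc u) ∘ suc)) (f≡0 {suc u} {zero} ℕ.z≤n))
                                   (ℤ.+-identityˡ _)) ⟩
    r + ∑∑ (λ u v → f (suc u) (suc v))
      ≡⟨ cong (_+_ r) (∑∑-upper (f≡0 ∘ ℕ.s≤s)) ⟩
    r + upperSum (λ u v → f (suc u) (suc v)) ∎
    where
    open ≡-Reasoning
    r = ∑[ v < n ] f zero (suc v)

  -- Second moments of centred quadratic forms.

  ∑-square : ∀ {k} a (f : Fin k → ℤ) → sum f ≡ 0ℤ →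
             ∑[ x < k ] ((a + f x) * (a + f x)) ≡ + k * (a * a) + ∑[ x < k ] (f x * f x)
  ∑-square {k} a f ∑f≡0 = begin
    ∑[ x < k ] ((a + f x) * (a + f x))
      ≡⟨ sum-cong-≗ (λ x → expand a (f x)) ⟩
    ∑[ x < k ] (a * a + (+ 2 * a * f x + f x * f x))
      ≡⟨ ∑-distrib-+ {k} (λ _ → a * a) _ ⟩
    ∑[ x < k ] (a * a) + ∑[ x < k ] (+ 2 * a * f x + f x * f x)
      ≡⟨ cong₂ _+_ (∑-const k (a * a)) (∑-distrib-+ (λ x → + 2 * a * f x) _) ⟩
    + k * (a * a) + (∑[ x < k ] (+ 2 * a * f x) + q)
      ≡⟨ cong (λ z → + k * (a * a) + (z + q)) (*-distribˡ-sum (+ 2 * a) f) ⟨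
    + k * (a * a) + (+ 2 * a * sum f + q)
      ≡⟨ cong (λ z → + k * (a * a) + (+ 2 * a * z + q)) ∑f≡0 ⟩
    + k * (a * a) + (+ 2 * a * 0ℤ + q)
      ≡⟨ drop (+ k * (a * a)) a q ⟩
    + k * (a * a) + q ∎
    where
    open ≡-Reasoning
    q = ∑[ x < k ] (f x * f x)
    expand : ∀ a y → (a + y) * (a + y) ≡ a * a + (+ 2 * a * y + y * y)
    expand = ℤRing.solve-∀
    drop : ∀ p a q → p + (+ 2 * a * 0ℤ + q) ≡ p + q
    drop = ℤRing.solve-∀

  -- If the classes c v are independent and uniform, Φ a l A is k² times the expected square of
  -- form a l A c: distinct terms of a centred form are uncorrelated.
  module CentredForm {k : ℕ} (g : Fin k → Fin k → ℤ)
    (columns : ∀ y → ∑[ x < k ] g x y ≡ 0ℤ) where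

    K Γ : ℤ
    K = + k
    Γ = ∑∑ (λ x y → g x y * g x y)

    -- Fixing the class of the first vertex turns its linear term into a constant and its pair terms
    -- into linear terms of the other vertices. A partially exposed form is therefore again a form,
    -- with new `a` and `l`.
    form : ∀ {n} → ℤ → (Fin n → Fin k → ℤ) → (Fin n → Fin n → ℤ) → (Fin n → Fin k) → ℤ
    form {zero}  a l A c = a
    form {suc n} a l A c =
      form (a + l zero (c zero)) (λ v y → l (suc v) y + A zero (suc v) * g (c zero) y)
           (λ u v → A (suc u) (suc v)) (c ∘ suc)

    Φ : ∀ {n} → ℤ → (Fin n → Fin k → ℤ) → (Fin n → Fin n → ℤ) → ℤ
    Φ a l A = K * K * (a * a) + K * ∑∑ (λ v x → l v x * l v x)
            + upperSum (λ u v → A u v * A u v) * Γ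

    form-expansion : ∀ {n} a l (A : Fin n → Fin n → ℤ) c →
      form a l A c ≡ a + ∑[ v < n ] l v (c v) + upperSum (λ u v → A u v * g (c u) (c v))
    form-expansion {zero}  a l A c = sym (trans (ℤ.+-identityʳ _) (ℤ.+-identityʳ a))
    form-expansion {suc n} a l A c = begin
      _ ≡⟨ form-expansion (a + l zero (c zero)) (λ v y → l (suc v) y + A zero (suc v) * g (c zero) y)
             (λ u v → A (suc u) (suc v)) (c ∘ suc) ⟩
      a + l zero (c zero) + ∑[ v < n ] (l (suc v) (c (suc v)) + A zero (suc v) * g (c zero) (c (suc v))) + q
        ≡⟨ cong (λ z → a + l zero (c zero) + z + q) (∑-distrib-+ (λ v → l (suc v) (c (suc v))) _) ⟩
      a + l zero (c zero) + (p + r) + q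
        ≡⟨ rearrange a _ p r q ⟩
      a + (l zero (c zero) + p) + (r + q) ∎
      where
      open ≡-Reasoning
      p = ∑[ v < n ] l (suc v) (c (suc v))
      r = ∑[ v < n ] (A zero (suc v) * g (c zero) (c (suc v)))
      q = upperSum (λ u v → A (suc u) (suc v) * g (c (suc u)) (c (suc v)))
      rearrange : ∀ a b p r q → a + b + (p + r) + q ≡ a + (b + p) + (r + q)
      rearrange = ℤRing.solve-∀

    -- With `y` fixed, `l y` is constant and column `y` of `g` sums to zero, so summing over `x`
    -- first kills the cross term.
    ∑∑-square : ∀ α (l : Fin k → ℤ) →
      ∑∑ (λ x y → (l y + α * g x y) * (l y + α * g x y)) ≡ K * ∑[ y < k ] (l y * l y) + α * α * Γ
    ∑∑-square α l = begin
      ∑∑ (λ x y → (l y + α * g x y) * (l y + α * g x y))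
        ≡⟨ ∑-comm (λ x y → (l y + α * g x y) * (l y + α * g x y)) ⟩
      ∑∑ (λ y x → (l y + α * g x y) * (l y + α * g x y))
        ≡⟨ sum-cong-≗ (λ y → ∑-square (l y) (λ x → α * g x y) (column y)) ⟩
      ∑[ y < k ] (K * (l y * l y) + ∑[ x < k ] (α * g x y * (α * g x y)))
        ≡⟨ ∑-distrib-+ (λ y → K * (l y * l y)) _ ⟩
      ∑[ y < k ] (K * (l y * l y)) + ∑∑ (λ y x → α * g x y * (α * g x y))
        ≡⟨ cong₂ _+_ (sym (*-distribˡ-sum K (λ y → l y * l y))) (∑-comm (λ y x → α * g x y * (α * g x y))) ⟩
      K * ∑[ y < k ] (l y * l y) + ∑∑ (λ x y → α * g x y * (α * g x y))
        ≡⟨ cong (λ z → K * ∑[ y < k ] (l y * l y) + z) (trans (∑∑-cong (λ x y → regroup α (g x y)))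
             (sym (*-distribˡ-∑∑ (α * α) (λ x y → g x y * g x y)))) ⟩
      K * ∑[ y < k ] (l y * l y) + α * α * Γ ∎
      where
      open ≡-Reasoning
      column : ∀ y → ∑[ x < k ] (α * g x y) ≡ 0ℤ
      column y = trans (sym (*-distribˡ-sum α (λ x → g x y))) (trans (cong (α *_) (columns y)) (ℤ.*-zeroʳ α))
      regroup : ∀ α y → α * y * (α * y) ≡ α * α * (y * y)
      regroup = ℤRing.solve-∀

    -- Exposing the class x of the first vertex preserves the expectation.
    ∑-Φ : ∀ {n} a (l : Fin (suc n) → Fin k → ℤ) A → sum (l zero) ≡ 0ℤ →
      ∑[ x < k ] Φ (a + l zero x) (λ v y → l (suc v) y + A zero (suc v) * g x y)
                   (λ u v → A (suc u) (suc v))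
      ≡ K * Φ a l A
    ∑-Φ {n} a l A ∑l₀≡0 = begin
      ∑[ x < k ] (K * K * (p x * p x) + K * q x + U * Γ)
        ≡⟨ ∑-distrib-+ (λ x → K * K * (p x * p x) + K * q x) _ ⟩
      ∑[ x < k ] (K * K * (p x * p x) + K * q x) + ∑[ x < k ] (U * Γ)
        ≡⟨ cong₂ _+_ (∑-distrib-+ (λ x → K * K * (p x * p x)) _) (∑-const k (U * Γ)) ⟩
      ∑[ x < k ] (K * K * (p x * p x)) + ∑[ x < k ] (K * q x) + K * (U * Γ)
        ≡⟨ cong₂ (λ y z → y + z + K * (U * Γ))
             (trans (sym (*-distribˡ-sum (K * K) (λ x → p x * p x))) (cong (K * K *_) (∑-square a (l zero) ∑l₀≡0)))
             (trans (sym (*-distribˡ-sum K q)) (cong (K *_) ∑q)) ⟩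
      K * K * (K * (a * a) + L₀) + K * (K * L₁ + α * Γ) + K * (U * Γ)
        ≡⟨ regroup K a L₀ L₁ α U Γ ⟩
      K * (K * K * (a * a) + K * (L₀ + L₁) + (α + U) * Γ) ∎
      where
      open ≡-Reasoning
      p q : Fin k → ℤ
      p x = a + l zero x
      q x = ∑∑ (λ v y → (l (suc v) y + A zero (suc v) * g x y) * (l (suc v) y + A zero (suc v) * g x y))
      U = upperSum (λ u v → A (suc u) (suc v) * A (suc u) (suc v))
      L₀ = ∑[ x < k ] (l zero x * l zero x)
      L₁ = ∑∑ (λ v x → l (suc v) x * l (suc v) x)
      α = ∑[ v < n ] (A zero (suc v) * A zero (suc v))
      ∑q : sum q ≡ K * L₁ + α * Γ
      ∑q = begin
        sum q
          ≡⟨ ∑-comm (λ x v → ∑[ y < k ] ((l (suc v) y + A zero (suc v) * g x y)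
                                       * (l (suc v) y + A zero (suc v) * g x y))) ⟩
        _ ≡⟨ sum-cong-≗ (λ v → ∑∑-square (A zero (suc v)) (l (suc v))) ⟩
        ∑[ v < n ] (K * ∑[ y < k ] (l (suc v) y * l (suc v) y) + A zero (suc v) * A zero (suc v) * Γ)
          ≡⟨ ∑-distrib-+ (λ v → K * ∑[ y < k ] (l (suc v) y * l (suc v) y)) _ ⟩
        _ ≡⟨ cong₂ _+_ (sym (*-distribˡ-sum K (λ v → ∑[ y < k ] (l (suc v) y * l (suc v) y))))
                        (sym (*-distribʳ-sum Γ (λ v → A zero (suc v) * A zero (suc v)))) ⟩
        K * L₁ + α * Γ ∎
      regroup : ∀ K a L₀ L₁ α U Γ →
        K * K * (K * (a * a) + L₀) + K * (K * L₁ + α * Γ) + K * (U * Γ)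
        ≡ K * (K * K * (a * a) + K * (L₀ + L₁) + (α + U) * Γ)
      regroup = ℤRing.solve-∀

  -- Derandomisation for several forms at once.

  module SimultaneousForms {k J : ℕ} (g : Fin J → Fin (suc k) → Fin (suc k) → ℤ)
    (rows    : ∀ j x → ∑[ y < suc k ] g j x y ≡ 0ℤ)
    (columns : ∀ j y → ∑[ x < suc k ] g j x y ≡ 0ℤ) where

    module C j = CentredForm (g j) (columns j)

    K : ℤ
    K = + suc k

    -- Method of conditional expectations. By `∑-Φ` the potential summed over `j` equals its average
    -- over the class of the first vertex, so some class does not increase it; fix that class and
    -- continue with the other vertices. Summing over `j` before choosing is what makes one choice
    -- serve all the forms.
    ∃-small-forms : ∀ {n} (a : Fin J → ℤ) (l : Fin J → Fin n → Fin (suc k) → ℤ) (A : Fin n → Fin n → ℤ) →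
      (∀ j v → sum (l j v) ≡ 0ℤ) →
      ∃[ c ] K * K * ∑[ j < J ] (C.form j (a j) (l j) A c * C.form j (a j) (l j) A c)
             ℤ.≤ ∑[ j < J ] C.Φ j (a j) (l j) A
    ∃-small-forms {zero} a l A centred =
      (λ ()) , ℤ.≤-reflexive (trans (*-distribˡ-sum (K * K) (λ j → a j * a j))
        (sum-cong-≗ λ j → no-vertices (K * K * (a j * a j)) K (C.Γ j)))
      where
      no-vertices : ∀ p K Γ → p ≡ p + K * 0ℤ + 0ℤ * Γ
      no-vertices = ℤRing.solve-∀
    ∃-small-forms {suc n} a l A centred =
      let x , Φₓ≤ = some-term≤average (λ x → ∑[ j < J ] Φ′ j x) (∑[ j < J ] C.Φ j (a j) (l j) A)
                      (ℤ.≤-reflexive average)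
          c , small = ∃-small-forms (λ j → a j + l j zero x)
                        (λ j v y → l j (suc v) y + A zero (suc v) * g j x y)
                        (λ u v → A (suc u) (suc v)) (λ j v → centred′ j v x)
      in x Vector.∷ c , ℤ.≤-trans small Φₓ≤
      where
      Φ′ : Fin J → Fin (suc k) → ℤ
      Φ′ j x = C.Φ j (a j + l j zero x) (λ v y → l j (suc v) y + A zero (suc v) * g j x y)
                 (λ u v → A (suc u) (suc v))
      average : ∑[ x < suc k ] ∑[ j < J ] Φ′ j x ≡ K * ∑[ j < J ] C.Φ j (a j) (l j) A
      average = trans (∑-comm (λ x j → Φ′ j x))
        (trans (sum-cong-≗ (λ j → C.∑-Φ j (a j) (l j) A (centred j zero)))
               (sym (*-distribˡ-sum K (λ j → C.Φ j (a j) (l j) A))))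
      -- The vanishing row sums keep the updated linear coefficients centred, as the recursive call
      -- requires.
      centred′ : ∀ j v x → ∑[ y < suc k ] (l j (suc v) y + A zero (suc v) * g j x y) ≡ 0ℤ
      centred′ j v x = trans (∑-distrib-+ (l j (suc v)) (λ y → A zero (suc v) * g j x y))
        (cong₂ _+_ (centred j (suc v))
          (trans (sym (*-distribˡ-sum (A zero (suc v)) (g j x)))
            (trans (cong (A zero (suc v) *_) (rows j x)) (ℤ.*-zeroʳ (A zero (suc v))))))

  *-monoˡ-≤ : ∀ {i j k} → 0ℤ ℤ.≤ k → i ℤ.≤ j → k * i ℤ.≤ k * j
  *-monoˡ-≤ {k = k} 0≤k i≤j = ℤ.*-monoˡ-≤-nonNeg k {{ℤ.nonNegative 0≤k}} i≤j

  0≤*  : ∀ {i j} → 0ℤ ℤ.≤ i → 0ℤ ℤ.≤ j → 0ℤ ℤ.≤ i * j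
  0≤* {i} {j} 0≤i 0≤j = subst (ℤ._≤ i * j) (ℤ.*-zeroʳ i) (*-monoˡ-≤ 0≤i 0≤j)

  0≤square : ∀ i → 0ℤ ℤ.≤ i * i
  0≤square (+ i) = 0≤* {+ i} (ℤ.+≤+ ℕ.z≤n) (ℤ.+≤+ ℕ.z≤n)
  0≤square ℤ.-[1+ i ] = ℤ.+≤+ ℕ.z≤n

  0≤∑ : ∀ {n} {f : Fin n → ℤ} → (∀ i → 0ℤ ℤ.≤ f i) → 0ℤ ℤ.≤ sum f
  0≤∑ {n} {f} 0≤f = subst (ℤ._≤ sum f) (∑-zero {n} λ _ → refl) (∑-mono 0≤f)

  -- Variance of the edge counts.

  module Deviation {k J : ℕ} (T : Fin J → Fin (suc k) → Fin (suc k) → ℤ)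
    (T-sym : ∀ j x y → T j x y ≡ T j y x)
    (T-idem : ∀ j x y → T j x y * T j x y ≡ T j x y) where

    K : ℤ
    K = + suc k

    -- Hoeffding decomposition: K² T j x y = P j + λ′ j x + λ′ j y + g j x y.
    R λ′ : Fin J → Fin (suc k) → ℤ
    P : Fin J → ℤ
    R j x = sum (T j x)
    P j = sum (R j)
    λ′ j x = K * R j x - P j

    g : Fin J → Fin (suc k) → Fin (suc k) → ℤ
    g j x y = K * K * T j x y - λ′ j x - λ′ j y - P j

    ∑λ′ : ∀ j → sum (λ′ j) ≡ 0ℤ
    ∑λ′ j = begin
      ∑[ x < suc k ] (K * R j x + - P j)
        ≡⟨ ∑-distrib-+ (λ x → K * R j x) (λ _ → - P j) ⟩
      ∑[ x < suc k ] (K * R j x) + ∑[ x < suc k ] (- P j)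
        ≡⟨ cong₂ _+_ (sym (*-distribˡ-sum K (R j))) (∑-const (suc k) (- P j)) ⟩
      K * P j + K * (- P j)
        ≡⟨ cancel K (P j) ⟩
      0ℤ ∎
      where
      open ≡-Reasoning
      cancel : ∀ K P → K * P + K * (- P) ≡ 0ℤ
      cancel = ℤRing.solve-∀

    rows : ∀ j x → sum (g j x) ≡ 0ℤ
    rows j x = begin
      ∑[ y < suc k ] g j x y
        ≡⟨ sum-cong-≗ (λ y → regroup (K * K * T j x y) (λ′ j x) (λ′ j y) (P j)) ⟩
      ∑[ y < suc k ] (K * K * T j x y + (- 1ℤ * λ′ j y + (- λ′ j x - P j)))
        ≡⟨ trans (∑-distrib-+ (λ y → K * K * T j x y) (λ y → - 1ℤ * λ′ j y + (- λ′ j x - P j)))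
                 (cong (λ z → ∑[ y < suc k ] (K * K * T j x y) + z)
                       (∑-distrib-+ (λ y → - 1ℤ * λ′ j y) (λ _ → - λ′ j x - P j))) ⟩
      ∑[ y < suc k ] (K * K * T j x y) + (∑[ y < suc k ] (- 1ℤ * λ′ j y) + ∑[ y < suc k ] (- λ′ j x - P j))
        ≡⟨ cong₂ _+_ (sym (*-distribˡ-sum (K * K) (T j x)))
             (cong₂ _+_ (trans (sym (*-distribˡ-sum (- 1ℤ) (λ′ j))) (cong (- 1ℤ *_) (∑λ′ j)))
                        (∑-const (suc k) (- λ′ j x - P j))) ⟩
      K * K * R j x + (- 1ℤ * 0ℤ + K * (- (K * R j x - P j) - P j))
        ≡⟨ cancel K (R j x) (P j) ⟩
      0ℤ ∎
      where
      open ≡-Reasoning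
      regroup : ∀ t a b p → t - a - b - p ≡ t + (- 1ℤ * b + (- a - p))
      regroup = ℤRing.solve-∀
      cancel : ∀ K R P → K * K * R + (- 1ℤ * 0ℤ + K * (- (K * R - P) - P)) ≡ 0ℤ
      cancel = ℤRing.solve-∀

    columns : ∀ j y → ∑[ x < suc k ] g j x y ≡ 0ℤ
    columns j y = trans (sum-cong-≗ λ x → trans
      (cong (λ t → K * K * t - λ′ j x - λ′ j y - P j) (T-sym j x y))
      (swap (K * K * T j y x) (λ′ j x) (λ′ j y) (P j))) (rows j y)
      where
      swap : ∀ t a b p → t - a - b - p ≡ t - b - a - p
      swap = ℤRing.solve-∀

    open SimultaneousForms g rows columns using (module C; ∃-small-forms)

    Λ : Fin J → ℤ
    Λ j = ∑[ x < suc k ] (λ′ j x * λ′ j x)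

    -- The variance of the 0/1-valued T j splits along the decomposition.
    variance : ∀ j → + 2 * K * Λ j + C.Γ j ≡ K * K * (P j * (K * K - P j))
    variance j = begin
      + 2 * K * Λ j + Γ
        ≡⟨ isolate K (P j) (Λ j) Γ ⟩
      K * (K * (P j * P j) + Λ j) + (K * Λ j + 1ℤ * 1ℤ * Γ) - K * K * (P j * P j)
        ≡⟨ cong₂ (λ y z → K * y + z - K * K * (P j * P j))
             (∑-square (P j) (λ′ j) (∑λ′ j)) (C.∑∑-square j 1ℤ (λ′ j)) ⟨
      K * ∑[ x < suc k ] ((P j + λ′ j x) * (P j + λ′ j x)) + ∑∑ (λ x y → f x y * f x y) - K * K * (P j * P j)
        ≡⟨ cong (_- K * K * (P j * P j)) total ⟩
      K * K * (K * K) * P j - K * K * (P j * P j)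
        ≡⟨ factor K (P j) ⟩
      K * K * (P j * (K * K - P j)) ∎
      where
      open ≡-Reasoning
      Γ = C.Γ j
      -- For fixed `x`, `K * K * T j x y` is the constant `P j + λ′ j x` plus `f x y`, and `f x`
      -- sums to zero over `y`. Hence `∑-square` applies row by row, and idempotence of `T j`
      -- evaluates the total second moment.
      f : Fin (suc k) → Fin (suc k) → ℤ
      f x y = λ′ j y + 1ℤ * g j x y
      isolate : ∀ K P Λ Γ → + 2 * K * Λ + Γ ≡ K * (K * (P * P) + Λ) + (K * Λ + 1ℤ * 1ℤ * Γ) - K * K * (P * P)
      isolate = ℤRing.solve-∀
      factor : ∀ K P → K * K * (K * K) * P - K * K * (P * P) ≡ K * K * (P * (K * K - P))
      factor = ℤRing.solve-∀
      cancel : ∀ kk t x y p → p + x + (y + 1ℤ * (kk * t - x - y - p)) ≡ kk * t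
      cancel = ℤRing.solve-∀
      square : ∀ kk t → kk * t * (kk * t) ≡ kk * kk * (t * t)
      square = ℤRing.solve-∀
      pointwise : ∀ x y → (P j + λ′ j x + f x y) * (P j + λ′ j x + f x y) ≡ K * K * (K * K) * T j x y
      pointwise x y = begin
        (P j + λ′ j x + f x y) * (P j + λ′ j x + f x y)
          ≡⟨ cong (λ z → z * z) (cancel (K * K) (T j x y) (λ′ j x) (λ′ j y) (P j)) ⟩
        K * K * T j x y * (K * K * T j x y)
          ≡⟨ square (K * K) (T j x y) ⟩
        K * K * (K * K) * (T j x y * T j x y)
          ≡⟨ cong (K * K * (K * K) *_) (T-idem j x y) ⟩
        K * K * (K * K) * T j x y ∎
      ∑f≡0 : ∀ x → sum (f x) ≡ 0ℤ
      ∑f≡0 x = trans (∑-distrib-+ (λ′ j) (λ y → 1ℤ * g j x y))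
        (cong₂ _+_ (∑λ′ j) (trans (sum-cong-≗ (λ y → ℤ.*-identityˡ (g j x y))) (rows j x)))
      total : K * ∑[ x < suc k ] ((P j + λ′ j x) * (P j + λ′ j x)) + ∑∑ (λ x y → f x y * f x y)
              ≡ K * K * (K * K) * P j
      total = begin
        K * ∑[ x < suc k ] ((P j + λ′ j x) * (P j + λ′ j x)) + ∑∑ (λ x y → f x y * f x y)
          ≡⟨ cong (_+ ∑∑ (λ x y → f x y * f x y)) (*-distribˡ-sum K (λ x → (P j + λ′ j x) * (P j + λ′ j x))) ⟩
        ∑[ x < suc k ] (K * ((P j + λ′ j x) * (P j + λ′ j x))) + ∑∑ (λ x y → f x y * f x y)
          ≡⟨ ∑-distrib-+ (λ x → K * ((P j + λ′ j x) * (P j + λ′ j x))) (λ x → ∑[ y < suc k ] (f x y * f x y)) ⟨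
        ∑[ x < suc k ] (K * ((P j + λ′ j x) * (P j + λ′ j x)) + ∑[ y < suc k ] (f x y * f x y))
          ≡⟨ sum-cong-≗ (λ x → ∑-square (P j + λ′ j x) (f x) (∑f≡0 x)) ⟨
        ∑∑ (λ x y → (P j + λ′ j x + f x y) * (P j + λ′ j x + f x y))
          ≡⟨ ∑∑-cong pointwise ⟩
        ∑∑ (λ x y → K * K * (K * K) * T j x y)
          ≡⟨ *-distribˡ-∑∑ (K * K * (K * K)) (T j) ⟨
        K * K * (K * K) * P j ∎

    -- `B` plays the strictly upper triangular 0/1 adjacency matrix of a graph. Then `m` is its
    -- number of edges, `d` its degree function, and `N j c` counts the edges whose pair of classes
    -- is selected by `T j`.
    module _ {n : ℕ} (B : Fin n → Fin n → ℤ)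
      (0≤B : ∀ u v → 0ℤ ℤ.≤ B u v)
      (B-idem : ∀ u v → B u v * B u v ≡ B u v)
      (B-upper : ∀ {u v} → toℕ v ℕ.≤ toℕ u → B u v ≡ 0ℤ) where

      m : ℤ
      m = ∑∑ B

      d : Fin n → ℤ
      d v = ∑[ u < n ] (B v u + B u v)

      0≤m : 0ℤ ℤ.≤ m
      0≤m = 0≤∑ (λ u → 0≤∑ (0≤B u))

      0≤d : ∀ v → 0ℤ ℤ.≤ d v
      0≤d v = 0≤∑ (λ u → ℤ.+-mono-≤ (0≤B v u) (0≤B u v))

      ∑d : sum d ≡ + 2 * m
      ∑d = begin
        ∑∑ (λ v u → B v u + B u v)
          ≡⟨ ∑∑-distrib-+ B (λ v u → B u v) ⟩
        m + ∑∑ (λ v u → B u v)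
          ≡⟨ cong (_+_ m) (∑-comm (λ v u → B u v)) ⟩
        m + m
          ≡⟨ double m ⟩
        + 2 * m ∎
        where
        open ≡-Reasoning
        double : ∀ m → m + m ≡ + 2 * m
        double = ℤRing.solve-∀

      N : Fin J → (Fin n → Fin (suc k)) → ℤ
      N j c = ∑∑ (λ u v → B u v * T j (c u) (c v))

      -- For independent uniform classes the expectation of `N j` is `m * P j` divided by `K * K`,
      -- so this is the deviation from the mean, scaled to stay in the integers.
      H : Fin J → (Fin n → Fin (suc k)) → ℤ
      H j c = K * K * N j c - m * P j

      -- Insert the Hoeffding decomposition into each edge. The constants add up to `m * P j`, the
      -- linear terms collect at each vertex with its degree as coefficient, and the pair terms keep
      -- the coefficients `B`.
      form≡H : ∀ j c → C.form j 0ℤ (λ v x → d v * λ′ j x) B c ≡ H j c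
      form≡H j c = begin
        C.form j 0ℤ (λ v x → d v * λ′ j x) B c
          ≡⟨ C.form-expansion j 0ℤ (λ v x → d v * λ′ j x) B c ⟩
        0ℤ + ∑[ v < n ] (d v * L v) + upperSum Bg
          ≡⟨ cong₂ (λ y z → 0ℤ + y + z) ∑dL
               (sym (∑∑-upper {f = Bg} λ {u} {v} v≤u →
                 trans (cong (_* g j (c u) (c v)) (B-upper v≤u)) (ℤ.*-zeroˡ (g j (c u) (c v))))) ⟩
        0ℤ + (∑∑ (λ v u → B v u * L v) + ∑∑ (λ u v → B u v * L v)) + ∑∑ Bg
          ≡⟨ regroup (∑∑ (λ v u → B v u * L v)) (∑∑ (λ u v → B u v * L v)) (∑∑ Bg) (m * P j) ⟩
        (∑∑ (λ u v → B u v * L u) + (∑∑ (λ u v → B u v * L v) + (∑∑ Bg + m * P j))) - m * P j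
          ≡⟨ cong (_- m * P j) split ⟨
        K * K * N j c - m * P j ∎
        where
        open ≡-Reasoning
        L : Fin n → ℤ
        L v = λ′ j (c v)
        Bg : Fin n → Fin n → ℤ
        Bg u v = B u v * g j (c u) (c v)
        ∑dL : ∑[ v < n ] (d v * L v) ≡ ∑∑ (λ v u → B v u * L v) + ∑∑ (λ u v → B u v * L v)
        ∑dL = begin
          ∑[ v < n ] (d v * L v)
            ≡⟨ sum-cong-≗ (λ v → trans (*-distribʳ-sum (L v) (λ u → B v u + B u v))
                 (sum-cong-≗ λ u → ℤ.*-distribʳ-+ (L v) (B v u) (B u v))) ⟩
          ∑∑ (λ v u → B v u * L v + B u v * L v)
            ≡⟨ ∑∑-distrib-+ (λ v u → B v u * L v) (λ v u → B u v * L v) ⟩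
          ∑∑ (λ v u → B v u * L v) + ∑∑ (λ v u → B u v * L v)
            ≡⟨ cong (_+_ (∑∑ (λ v u → B v u * L v))) (∑-comm (λ v u → B u v * L v)) ⟩
          ∑∑ (λ v u → B v u * L v) + ∑∑ (λ u v → B u v * L v) ∎
        regroup : ∀ a b q r → 0ℤ + (a + b) + q ≡ (a + (b + (q + r))) - r
        regroup = ℤRing.solve-∀
        decompose : ∀ kk b t x y p → kk * (b * t) ≡ b * x + (b * y + (b * (kk * t - x - y - p) + b * p))
        decompose = ℤRing.solve-∀
        split : K * K * N j c ≡ ∑∑ (λ u v → B u v * L u) + (∑∑ (λ u v → B u v * L v) + (∑∑ Bg + m * P j))
        split = begin
          K * K * N j c
            ≡⟨ *-distribˡ-∑∑ (K * K) (λ u v → B u v * T j (c u) (c v)) ⟩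
          ∑∑ (λ u v → K * K * (B u v * T j (c u) (c v)))
            ≡⟨ ∑∑-cong (λ u v → decompose (K * K) (B u v) (T j (c u) (c v)) (L u) (L v) (P j)) ⟩
          ∑∑ (λ u v → B u v * L u + (B u v * L v + (Bg u v + B u v * P j)))
            ≡⟨ ∑∑-distrib-+ (λ u v → B u v * L u) (λ u v → B u v * L v + (Bg u v + B u v * P j)) ⟩
          ∑∑ (λ u v → B u v * L u) + ∑∑ (λ u v → B u v * L v + (Bg u v + B u v * P j))
            ≡⟨ cong (_+_ (∑∑ (λ u v → B u v * L u)))
                 (trans (∑∑-distrib-+ (λ u v → B u v * L v) (λ u v → Bg u v + B u v * P j))
                   (cong (_+_ (∑∑ (λ u v → B u v * L v)))
                     (trans (∑∑-distrib-+ Bg (λ u v → B u v * P j))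
                       (cong (_+_ (∑∑ Bg)) (sym (trans (*-distribʳ-sum (P j) (sum ∘ B))
                         (sum-cong-≗ λ u → *-distribʳ-sum (P j) (B u)))))))) ⟩
          ∑∑ (λ u v → B u v * L u) + (∑∑ (λ u v → B u v * L v) + (∑∑ Bg + m * P j)) ∎

      module _ {Δ : ℤ} (1≤Δ : 1ℤ ℤ.≤ Δ) (d≤Δ : ∀ v → d v ℤ.≤ Δ) where

        ∑d²≤ : ∑[ v < n ] (d v * d v) ℤ.≤ Δ * (+ 2 * m)
        ∑d²≤ = begin
          ∑[ v < n ] (d v * d v)  ≤⟨ ∑-mono (λ v → *-monoˡ-≤ (0≤d v) (d≤Δ v)) ⟩
          ∑[ v < n ] (d v * Δ)    ≡⟨ *-distribʳ-sum Δ d ⟨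
          sum d * Δ               ≡⟨ cong (_* Δ) ∑d ⟩
          + 2 * m * Δ             ≡⟨ ℤ.*-comm (+ 2 * m) Δ ⟩
          Δ * (+ 2 * m)           ∎
          where open ℤ.≤-Reasoning

        -- The linear part is controlled by `∑d²≤`, and the pair part is multiplied by `Δ`, which is
        -- at least 1. Both then carry the factor `m * Δ`, and what remains is the left side of
        -- `variance`.
        Φ≤ : ∀ j → C.Φ j 0ℤ (λ v x → d v * λ′ j x) B ℤ.≤ K * K * (m * Δ * (P j * (K * K - P j)))
        Φ≤ j = begin
          K * K * (0ℤ * 0ℤ) + K * ∑∑ (λ v x → d v * λ′ j x * (d v * λ′ j x))
            + upperSum (λ u v → B u v * B u v) * C.Γ j
            ≡⟨ cong₂ (λ y z → K * K * (0ℤ * 0ℤ) + K * y + z * C.Γ j) linear quadratic ⟩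
          K * K * (0ℤ * 0ℤ) + K * (D * Λ j) + m * C.Γ j
            ≡⟨ regroup K D (Λ j) m (C.Γ j) ⟩
          K * Λ j * D + C.Γ j * m * 1ℤ
            ≤⟨ ℤ.+-mono-≤ (*-monoˡ-≤ (0≤* {K} (ℤ.+≤+ ℕ.z≤n) (0≤∑ (λ x → 0≤square (λ′ j x)))) ∑d²≤)
                          (*-monoˡ-≤ (0≤* (0≤∑ (λ x → 0≤∑ (λ y → 0≤square (g j x y)))) 0≤m) 1≤Δ) ⟩
          K * Λ j * (Δ * (+ 2 * m)) + C.Γ j * m * Δ
            ≡⟨ collect K (Λ j) Δ m (C.Γ j) ⟩
          m * Δ * (+ 2 * K * Λ j + C.Γ j)
            ≡⟨ cong (m * Δ *_) (variance j) ⟩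
          m * Δ * (K * K * (P j * (K * K - P j)))
            ≡⟨ commute (m * Δ) (K * K) (P j * (K * K - P j)) ⟩
          K * K * (m * Δ * (P j * (K * K - P j))) ∎
          where
          open ℤ.≤-Reasoning
          commute : ∀ a b c → a * (b * c) ≡ b * (a * c)
          commute = ℤRing.solve-∀
          D = ∑[ v < n ] (d v * d v)
          regroup : ∀ K D L m γ → K * K * (0ℤ * 0ℤ) + K * (D * L) + m * γ ≡ K * L * D + γ * m * 1ℤ
          regroup = ℤRing.solve-∀
          collect : ∀ K L Δ m γ → K * L * (Δ * (+ 2 * m)) + γ * m * Δ ≡ m * Δ * (+ 2 * K * L + γ)
          collect = ℤRing.solve-∀
          interchange : ∀ a b → a * b * (a * b) ≡ a * a * (b * b)
          interchange = ℤRing.solve-∀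
          linear : ∑∑ (λ v x → d v * λ′ j x * (d v * λ′ j x)) ≡ D * Λ j
          linear = trans (sum-cong-≗ λ v → trans (sum-cong-≗ λ x → interchange (d v) (λ′ j x))
                       (sym (*-distribˡ-sum (d v * d v) (λ x → λ′ j x * λ′ j x))))
                     (sym (*-distribʳ-sum (Λ j) (λ v → d v * d v)))
          quadratic : upperSum (λ u v → B u v * B u v) ≡ m
          quadratic = trans (upperSum-cong B-idem) (sym (∑∑-upper B-upper))

        ∃-small-deviations : ∃[ c ] ∑[ j < J ] (H j c * H j c) ℤ.≤ m * Δ * ∑[ j < J ] (P j * (K * K - P j))
        ∃-small-deviations =
          let c , small = ∃-small-forms (λ _ → 0ℤ) (λ j v x → d v * λ′ j x) B centred
          in c , ℤ.*-cancelˡ-≤-pos _ _ (K * K) (begin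
            K * K * ∑[ j < J ] (H j c * H j c)
              ≡⟨ cong (K * K *_) (sum-cong-≗ λ j → cong (λ h → h * h) (form≡H j c)) ⟨
            K * K * ∑[ j < J ] (C.form j 0ℤ (λ v x → d v * λ′ j x) B c
                              * C.form j 0ℤ (λ v x → d v * λ′ j x) B c)
              ≤⟨ small ⟩
            ∑[ j < J ] C.Φ j 0ℤ (λ v x → d v * λ′ j x) B
              ≤⟨ ∑-mono Φ≤ ⟩
            ∑[ j < J ] (K * K * (m * Δ * (P j * (K * K - P j))))
              ≡⟨ *-distribˡ-sum (K * K) (λ j → m * Δ * (P j * (K * K - P j))) ⟨
            K * K * ∑[ j < J ] (m * Δ * (P j * (K * K - P j)))
              ≡⟨ cong (K * K *_) (*-distribˡ-sum (m * Δ) (λ j → P j * (K * K - P j))) ⟨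
            K * K * (m * Δ * ∑[ j < J ] (P j * (K * K - P j))) ∎)
          where
          open ℤ.≤-Reasoning
          centred : ∀ j v → ∑[ x < suc k ] (d v * λ′ j x) ≡ 0ℤ
          centred j v = trans (sym (*-distribˡ-sum (d v) (λ′ j)))
            (trans (cong (d v *_) (∑λ′ j)) (ℤ.*-zeroʳ (d v)))

-- Levels, classes and their numerical constants.

module Labellings where

  open Forms
  open import Data.Nat using (_+_; _*_; _∸_; _≤_; _<_; _≤?_; _/_; _%_)

  -- The Iverson bracket, taken in the integers so that cardinalities become sums.
  [_] : ∀ {p} {P : Set p} → Dec P → ℤ
  [ P? ] = if does P? then 1ℤ else 0ℤ

  0≤[] : ∀ {p} {P : Set p} (P? : Dec P) → 0ℤ ℤ.≤ [ P? ]
  0≤[] (true  because _) = ℤ.+≤+ z≤n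
  0≤[] (false because _) = ℤ.+≤+ z≤n

  []-idem : ∀ {p} {P : Set p} (P? : Dec P) → [ P? ] ℤ.* [ P? ] ≡ [ P? ]
  []-idem (true  because _) = refl
  []-idem (false because _) = refl

  []-false : ∀ {p} {P : Set p} (P? : Dec P) → ¬ P → [ P? ] ≡ 0ℤ
  []-false P? ¬p = cong (if_then 1ℤ else 0ℤ) (dec-false P? ¬p)

  []-disjoint : ∀ {p q r} {P : Set p} {Q : Set q} {R : Set r} (P? : Dec P) (Q? : Dec Q) (R? : Dec R) →
                (P → ¬ Q) → (P → R) → (Q → R) → [ P? ] ℤ.+ [ Q? ] ℤ.≤ [ R? ]
  []-disjoint (yes p) (yes q) R?      p⇒¬q p⇒r q⇒r = contradiction q (p⇒¬q p)
  []-disjoint (yes p) (no _)  (yes _) p⇒¬q p⇒r q⇒r = ℤ.≤-refl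
  []-disjoint (yes p) (no _)  (no ¬r) p⇒¬q p⇒r q⇒r = contradiction (p⇒r p) ¬r
  []-disjoint (no _)  (yes _) (yes _) p⇒¬q p⇒r q⇒r = ℤ.≤-refl
  []-disjoint (no _)  (yes q) (no ¬r) p⇒¬q p⇒r q⇒r = contradiction (q⇒r q) ¬r
  []-disjoint (no _)  (no _)  R?      p⇒¬q p⇒r q⇒r = 0≤[] R?

  -- Level i stands for the (shifted) vertex weight ⌊ i s / 5 ⌋.
  level : Fin 12 → ℕ
  level = Vec.lookup (0 ∷ 0 ∷ 0 ∷ 0 ∷ 1 ∷ 2 ∷ 3 ∷ 4 ∷ 5 ∷ 5 ∷ 5 ∷ 5 ∷ [])

  -- expected j counts the pairs of classes, out of 144, whose levels add up to at most j.
  expected : Fin 10 → ℕ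
  expected = Vec.lookup (16 ∷ 24 ∷ 33 ∷ 43 ∷ 54 ∷ 90 ∷ 101 ∷ 111 ∷ 120 ∷ 128 ∷ [])

  T : Fin 10 → Fin 12 → Fin 12 → ℤ
  T j x y = [ level x + level y ≤? toℕ j ]

  T-sym : ∀ j x y → T j x y ≡ T j y x
  T-sym j x y = cong (λ i → [ i ≤? toℕ j ]) (ℕ.+-comm (level x) (level y))

  T-idem : ∀ j x y → T j x y ℤ.* T j x y ≡ T j x y
  T-idem j x y = []-idem (level x + level y ≤? toℕ j)

  module Dev = Deviation T T-sym T-idem

  P≡expected : ∀ j → Dev.P j ≡ + expected j
  P≡expected = from-yes (all? λ j → Dev.P j ℤ.≟ + expected j)

  -- 39150 = 9 · 4350, so that by Chebyshev every count is off by at most 3 m / 144.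
  ∑variance≤ : ∑[ j < 10 ] (Dev.P j ℤ.* (Dev.K ℤ.* Dev.K ℤ.- Dev.P j)) ℤ.≤ + 39150
  ∑variance≤ = ℤ.≤-trans
    (ℤ.≤-reflexive (sum-cong-≗ λ j → cong (λ p → p ℤ.* (Dev.K ℤ.* Dev.K ℤ.- p)) (P≡expected j)))
    (from-yes (∑[ j < 10 ] (+ expected j ℤ.* (+ 144 ℤ.- + expected j)) ℤ.≤? + 39150))

  square-cancel-≤ : ∀ {h b} → 0ℤ ℤ.≤ b → h ℤ.* h ℤ.≤ b ℤ.* b → h ℤ.≤ b
  square-cancel-≤ {h} {b} 0≤b h²≤b² = ℤ.≮⇒≥ λ b<h → ℤ.<⇒≱ (begin-strict
    b ℤ.* b  ≤⟨ *-monoˡ-≤ 0≤b (ℤ.<⇒≤ b<h) ⟩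
    b ℤ.* h  <⟨ ℤ.*-monoʳ-<-pos h {{ℤ.positive (ℤ.≤-<-trans 0≤b b<h)}} b<h ⟩
    h ℤ.* h  ∎) h²≤b²
    where open ℤ.≤-Reasoning

  -- Translation of list lengths into finite sums.

  module _ {a : Level} {A : Set a} where

    ∑ˡ : (A → ℤ) → List A → ℤ
    ∑ˡ f = foldr (λ x s → f x ℤ.+ s) 0ℤ

    ∑ˡ-++ : ∀ f xs ys → ∑ˡ f (xs ++ ys) ≡ ∑ˡ f xs ℤ.+ ∑ˡ f ys
    ∑ˡ-++ f []       ys = sym (ℤ.+-identityˡ (∑ˡ f ys))
    ∑ˡ-++ f (x ∷ xs) ys =
      trans (cong (ℤ._+_ (f x)) (∑ˡ-++ f xs ys)) (sym (ℤ.+-assoc (f x) (∑ˡ f xs) (∑ˡ f ys)))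

    ∑ˡ-tabulate : ∀ f {n} (h : Fin n → A) → ∑ˡ f (tabulate h) ≡ ∑[ i < n ] f (h i)
    ∑ˡ-tabulate f {zero}  h = refl
    ∑ˡ-tabulate f {suc n} h = cong (ℤ._+_ (f (h zero))) (∑ˡ-tabulate f (h ∘ suc))

    module _ {p : Level} {P : Pred A p} (P? : Decidable P) where

      ∑ˡ-filter : ∀ f xs → ∑ˡ f (filter P? xs) ≡ ∑ˡ (λ x → [ P? x ] ℤ.* f x) xs
      ∑ˡ-filter f []       = refl
      ∑ˡ-filter f (x ∷ xs) with does (P? x)
      ... | true  = cong₂ ℤ._+_ (sym (ℤ.*-identityˡ (f x))) (∑ˡ-filter f xs)
      ... | false = trans (∑ˡ-filter f xs) (sym (trans (cong (ℤ._+ rest) (ℤ.*-zeroˡ (f x))) (ℤ.+-identityˡ rest)))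
        where rest = ∑ˡ (λ x → [ P? x ] ℤ.* f x) xs

      length-filter≡∑ˡ : ∀ xs → + length (filter P? xs) ≡ ∑ˡ (λ x → [ P? x ]) xs
      length-filter≡∑ˡ []       = refl
      length-filter≡∑ˡ (x ∷ xs) with does (P? x)
      ... | true  = cong (ℤ._+_ 1ℤ) (length-filter≡∑ˡ xs)
      ... | false = trans (length-filter≡∑ˡ xs) (sym (ℤ.+-identityˡ _))

    length≡∑ˡ : ∀ (xs : List A) → + length xs ≡ ∑ˡ (λ _ → 1ℤ) xs
    length≡∑ˡ []       = refl
    length≡∑ˡ (x ∷ xs) = cong (ℤ._+_ 1ℤ) (length≡∑ˡ xs)

  ∑ˡ-cartesianProduct : ∀ {a b} {A : Set a} {B : Set b} (f : A × B → ℤ) {m n} (g : Fin m → A) (h : Fin n → B) →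
    ∑ˡ f (cartesianProduct (tabulate g) (tabulate h)) ≡ ∑∑ (λ i j → f (g i , h j))
  ∑ˡ-cartesianProduct f {zero}  g h = refl
  ∑ˡ-cartesianProduct f {suc m} g h = begin
    ∑ˡ f (map (g zero ,_) (tabulate h) ++ rest)
      ≡⟨ ∑ˡ-++ f (map (g zero ,_) (tabulate h)) rest ⟩
    ∑ˡ f (map (g zero ,_) (tabulate h)) ℤ.+ ∑ˡ f rest
      ≡⟨ cong₂ ℤ._+_ (trans (cong (∑ˡ f) (map-tabulate h (g zero ,_))) (∑ˡ-tabulate f (λ j → g zero , h j)))
                     (∑ˡ-cartesianProduct f (g ∘ suc) h) ⟩
    ∑∑ (λ i j → f (g i , h j)) ∎
    where
    open ≡-Reasoning
    rest = cartesianProduct (tabulate (g ∘ suc)) (tabulate h)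

  -- Balanced class assignments of a graph.

  module _ (G : Graph) where
    open Graph G

    B : Vertex → Vertex → ℤ
    B u v = [ (u <? v) ×-dec adj? u v ]

    ∑-edgePairs : ∀ f → ∑ˡ f edgePairs ≡ ∑∑ (λ u v → B u v ℤ.* f (u , v))
    ∑-edgePairs f =
      trans (∑ˡ-filter (λ (u , v) → (u <? v) ×-dec adj? u v) f (cartesianProduct (allFin order) (allFin order)))
            (∑ˡ-cartesianProduct (λ (u , v) → B u v ℤ.* f (u , v)) id id)

    size≡∑∑ : + size ≡ ∑∑ B
    size≡∑∑ = trans (length≡∑ˡ edgePairs)
      (trans (∑-edgePairs (λ _ → 1ℤ)) (∑∑-cong λ u v → ℤ.*-identityʳ (B u v)))

    B-upper : ∀ {u v} → toℕ v ≤ toℕ u → B u v ≡ 0ℤ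
    B-upper {u} {v} v≤u = []-false ((u <? v) ×-dec adj? u v) λ (u<v , _) → ℕ.<⇒≱ u<v v≤u

    -- An edge is stored in one orientation only, so each neighbour of `v` contributes at most once
    -- to the two summands.
    B-adjacent : ∀ v u → B v u ℤ.+ B u v ℤ.≤ [ adj? v u ]
    B-adjacent v u = []-disjoint ((v <? u) ×-dec adj? v u) ((u <? v) ×-dec adj? u v) (adj? v u)
      (λ (v<u , _) (u<v , _) → ℕ.<-asym v<u u<v) proj₂ (adj-sym ∘ proj₂)

    degree≤maxDegree : ∀ v → degree v ≤ maxDegree
    degree≤maxDegree v =
      All.lookup (xs≤max 0 (map degree (allFin order))) (∈-map⁺ degree (∈-allFin v))

    incidences≤maxDegree : ∀ v → ∑[ u < order ] (B v u ℤ.+ B u v) ℤ.≤ + maxDegree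
    incidences≤maxDegree v = begin
      ∑[ u < order ] (B v u ℤ.+ B u v)  ≤⟨ ∑-mono (B-adjacent v) ⟩
      ∑[ u < order ] [ adj? v u ]       ≡⟨ ∑ˡ-tabulate (λ u → [ adj? v u ]) id ⟨
      ∑ˡ (λ u → [ adj? v u ]) (allFin order) ≡⟨ length-filter≡∑ˡ (adj? v) (allFin order) ⟨
      + degree v                        ≤⟨ ℤ.+≤+ (degree≤maxDegree v) ⟩
      + maxDegree                       ∎
      where open ℤ.≤-Reasoning

    pairLevel : (Vertex → Fin 12) → Vertex × Vertex → ℕ
    pairLevel c (u , v) = level (c u) + level (c v)

    #≤ : (Vertex → Fin 12) → ℕ → ℕ
    #≤ c j = length (filter (λ e → pairLevel c e ≤? j) edgePairs)

    0≤B : ∀ u v → 0ℤ ℤ.≤ B u v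
    0≤B u v = 0≤[] ((u <? v) ×-dec adj? u v)

    B-idem : ∀ u v → B u v ℤ.* B u v ≡ B u v
    B-idem u v = []-idem ((u <? v) ×-dec adj? u v)

    Balanced : (Vertex → Fin 12) → Set
    Balanced c = ∀ j → size * expected j ≤ 144 * #≤ c (toℕ j) + 3 * size
                     × 144 * #≤ c (toℕ j) ≤ size * expected j + 3 * size

    -- A single squared deviation is at most the sum of all ten, hence at most `39150 * m * Δ`. With
    -- `4350 * Δ ≤ m` this is at most the square of `3 * m`, and taking roots gives both
    -- inequalities.
    ∃-balanced : 1 ≤ maxDegree → 4350 * maxDegree ≤ size →
      ∃[ c ] Balanced c
    ∃-balanced 1≤Δ 4350Δ≤m =
      let c , ∑H²≤ = Dev.∃-small-deviations B 0≤B B-idem B-upper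
                       {+ maxDegree} (ℤ.+≤+ 1≤Δ) incidences≤maxDegree
      in c , λ j → bounds c j (H²≤ c j ∑H²≤)
      where
      open ℤ.≤-Reasoning
      m = + size
      b = + (3 * size)
      H : Fin 10 → (Vertex → Fin 12) → ℤ
      H = Dev.H B 0≤B B-idem B-upper
      H≡ : ∀ c j → H j c ≡ + (144 * #≤ c (toℕ j)) ℤ.- + (size * expected j)
      H≡ c j = cong₂ ℤ._-_
        (trans (cong (+ 144 ℤ.*_) (sym (trans (length-filter≡∑ˡ (λ e → pairLevel c e ≤? toℕ j) edgePairs)
                 (∑-edgePairs (λ e → [ pairLevel c e ≤? toℕ j ])))))
               (sym (ℤ.pos-* 144 (#≤ c (toℕ j)))))
        (trans (cong₂ ℤ._*_ (sym size≡∑∑) (P≡expected j)) (sym (ℤ.pos-* size (expected j))))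
      H²≤ : ∀ c j → ∑[ j < 10 ] (H j c ℤ.* H j c) ℤ.≤
            ∑∑ B ℤ.* + maxDegree ℤ.* ∑[ j < 10 ] (Dev.P j ℤ.* (Dev.K ℤ.* Dev.K ℤ.- Dev.P j)) →
            H j c ℤ.* H j c ℤ.≤ b ℤ.* b
      H²≤ c j small = begin
        H j c ℤ.* H j c
          ≤⟨ term≤∑ (λ i → 0≤square (H i c)) j ⟩
        ∑[ j < 10 ] (H j c ℤ.* H j c)
          ≤⟨ small ⟩
        ∑∑ B ℤ.* + maxDegree ℤ.* ∑[ j < 10 ] (Dev.P j ℤ.* (Dev.K ℤ.* Dev.K ℤ.- Dev.P j))
          ≡⟨ cong (λ z → z ℤ.* + maxDegree ℤ.* ∑[ j < 10 ] (Dev.P j ℤ.* (Dev.K ℤ.* Dev.K ℤ.- Dev.P j))) size≡∑∑ ⟨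
        m ℤ.* + maxDegree ℤ.* ∑[ j < 10 ] (Dev.P j ℤ.* (Dev.K ℤ.* Dev.K ℤ.- Dev.P j))
          ≤⟨ *-monoˡ-≤ (0≤* {m} (ℤ.+≤+ z≤n) (ℤ.+≤+ z≤n)) ∑variance≤ ⟩
        m ℤ.* + maxDegree ℤ.* + 39150
          ≡⟨ regroup m (+ maxDegree) ⟩
        + 9 ℤ.* m ℤ.* (+ 4350 ℤ.* + maxDegree)
          ≤⟨ *-monoˡ-≤ (0≤* {+ 9} {m} (ℤ.+≤+ z≤n) (ℤ.+≤+ z≤n))
               (subst (ℤ._≤ m) (ℤ.pos-* 4350 maxDegree) (ℤ.+≤+ 4350Δ≤m)) ⟩
        + 9 ℤ.* m ℤ.* m
          ≡⟨ square m ⟩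
        + 3 ℤ.* m ℤ.* (+ 3 ℤ.* m)
          ≡⟨ cong (λ z → z ℤ.* z) (ℤ.pos-* 3 size) ⟨
        b ℤ.* b ∎
        where
        regroup : ∀ m Δ → m ℤ.* Δ ℤ.* + 39150 ≡ + 9 ℤ.* m ℤ.* (+ 4350 ℤ.* Δ)
        regroup = ℤRing.solve-∀
        square : ∀ m → + 9 ℤ.* m ℤ.* m ≡ + 3 ℤ.* m ℤ.* (+ 3 ℤ.* m)
        square = ℤRing.solve-∀
      within : ∀ x y b → (+ x ℤ.- + y) ℤ.* (+ x ℤ.- + y) ℤ.≤ + b ℤ.* + b → x ≤ y + b
      within x y b h²≤b² = ℤ.drop‿+≤+ (begin
        + x                    ≡⟨ split (+ x) (+ y) ⟩
        + y ℤ.+ (+ x ℤ.- + y)  ≤⟨ ℤ.+-monoʳ-≤ (+ y) (square-cancel-≤ {+ x ℤ.- + y} (ℤ.+≤+ z≤n) h²≤b²) ⟩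
        + y ℤ.+ + b            ∎)
        where
        split : ∀ x y → x ≡ y ℤ.+ (x ℤ.- y)
        split = ℤRing.solve-∀
      negate : ∀ x y → (x ℤ.- y) ℤ.* (x ℤ.- y) ≡ (y ℤ.- x) ℤ.* (y ℤ.- x)
      negate = ℤRing.solve-∀
      bounds : ∀ c j → H j c ℤ.* H j c ℤ.≤ b ℤ.* b →
               size * expected j ≤ 144 * #≤ c (toℕ j) + 3 * size
               × 144 * #≤ c (toℕ j) ≤ size * expected j + 3 * size
      bounds c j h²≤b² =
        within (size * expected j) (144 * #≤ c (toℕ j)) (3 * size)
          (subst (ℤ._≤ b ℤ.* b) (negate (+ (144 * #≤ c (toℕ j))) (+ (size * expected j))) h′²≤b²) ,
        within (144 * #≤ c (toℕ j)) (size * expected j) (3 * size) h′²≤b²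
        where
        h′²≤b² = subst (λ h → h ℤ.* h ℤ.≤ b ℤ.* b) (H≡ c j) h²≤b²

  -- Comparing lengths of filtered lists.

  module _ {a p q : Level} {A : Set a} {P : Pred A p} {Q : Pred A q}
           (P? : Decidable P) (Q? : Decidable Q)
           (P⇒Q : ∀ {x} → P x → Q x) where

    length-filter-mono-≤ : ∀ xs → length (filter P? xs) ≤ length (filter Q? xs)
    length-filter-mono-≤ []       = z≤n
    length-filter-mono-≤ (x ∷ xs) with P? x | Q? x
    ... | yes p | no ¬q = contradiction (P⇒Q p) ¬q
    ... | yes _ | yes _ = s≤s (length-filter-mono-≤ xs)
    ... | no _  | yes _ = ℕ.m≤n⇒m≤1+n (length-filter-mono-≤ xs)
    ... | no _  | no _  = length-filter-mono-≤ xs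

    length-filter-mono-< : ∀ {x xs} → x ∈ xs → Q x → ¬ P x → length (filter P? xs) < length (filter Q? xs)
    length-filter-mono-< {x} {_ ∷ xs} (here refl) q ¬p with P? x | Q? x
    ... | yes p | _     = contradiction p ¬p
    ... | no _  | yes _ = s≤s (length-filter-mono-≤ xs)
    ... | no _  | no ¬q = contradiction q ¬q
    length-filter-mono-< {_} {y ∷ xs} (there x∈xs) q ¬p with P? y | Q? y
    ... | yes p | no ¬q = contradiction (P⇒Q p) ¬q
    ... | yes _ | yes _ = s≤s (length-filter-mono-< x∈xs q ¬p)
    ... | no _  | yes _ = ℕ.m≤n⇒m≤1+n (length-filter-mono-< x∈xs q ¬p)
    ... | no _  | no _  = length-filter-mono-< x∈xs q ¬p

  lookup-injective : ∀ {a} {A : Set a} {xs : List A} → Unique xs →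
                     ∀ {i j} → List.lookup xs i ≡ List.lookup xs j → i ≡ j
  lookup-injective (x∉ ∷ u) {zero}  {zero}  eq = refl
  lookup-injective (x∉ ∷ u) {zero}  {suc j} eq = contradiction eq (All.lookup x∉ (∈-lookup j))
  lookup-injective (x∉ ∷ u) {suc i} {zero}  eq = contradiction (sym eq) (All.lookup x∉ (∈-lookup i))
  lookup-injective (x∉ ∷ u) {suc i} {suc j} eq = cong suc (lookup-injective u eq)

  -- Arithmetic of the ceiling.

  3*-cancel-≤ : ∀ {a b} → 3 * a ≤ 3 * b + 2 → a ≤ b
  3*-cancel-≤ {a} {b} 3a≤3b+2 =
    ℕ.s≤s⁻¹ (ℕ.*-cancelˡ-< 3 a (suc b) (ℕ.≤-trans (s≤s 3a≤3b+2) (ℕ.≤-reflexive (next b))))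
    where
    next : ∀ b → suc (3 * b + 2) ≡ 3 * suc b
    next = ℕRing.solve-∀

  -- The quotient is the ceiling of (m - 1) / 3 written without subtraction: the largest label after
  -- shifting all labels down by 1. The successor undoes the shift.
  ⌈/3⌉ : ℕ → ℕ
  ⌈/3⌉ m = suc ((m + 1) / 3)

  module _ (m : ℕ) where
    private
      s = (m + 1) / 3

    3s≤m+1 : 3 * s ≤ m + 1
    3s≤m+1 = subst (_≤ m + 1) (ℕ.*-comm s 3) (m/n*n≤m (m + 1) 3)

    m≤3s+1 : m ≤ 3 * s + 1
    m≤3s+1 = ℕ.+-cancelʳ-≤ 1 m (3 * s + 1) (begin
      m + 1                ≡⟨ m≡m%n+[m/n]*n (m + 1) 3 ⟩
      (m + 1) % 3 + s * 3  ≤⟨ ℕ.+-monoˡ-≤ (s * 3) (ℕ.s≤s⁻¹ (m%n<n (m + 1) 3)) ⟩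
      2 + s * 3            ≡⟨ regroup s ⟩
      3 * s + 1 + 1        ∎)
      where
      open ℕ.≤-Reasoning
      regroup : ∀ s → 2 + s * 3 ≡ 3 * s + 1 + 1
      regroup = ℕRing.solve-∀

  -- The interval from `m + 2` to `m + 4` contains exactly one multiple of 3, so it remains to
  -- compare `t` with the computed ceiling.
  ceiling-unique : ∀ m t → 3 * t ≤ m + 4 → m + 2 ≤ 3 * t → + t ≡ ℚ.ceiling ((+ (m + 2)) ℚ./ 3)
  -- `ceiling` negates the floor of the negated fraction. With the numerator in successor form the
  -- negation computes, and division of a negative integer then branches on whether the remainder is
  -- zero.
  ceiling-unique m t 3t≤ ≤3t rewrite ℕ.+-comm m 2
    with suc (suc m) % 3 | m≡m%n+[m/n]*n (suc (suc m)) 3 | m%n<n (suc (suc m)) 3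
  ... | zero  | eq | _ = begin
    + t                            ≡⟨ cong +_ (ℕ.≤-antisym t≤q q≤t) ⟩
    + q                            ≡⟨ ℤ.neg-involutive (+ q) ⟨
    ℤ.- (ℤ.- + q)                  ≡⟨ cong ℤ.-_ (ℤ.*-identityˡ (ℤ.- + q)) ⟨
    ℤ.- (1ℤ ℤ.* (ℤ.- + q))         ∎
    where
    open ≡-Reasoning
    q = suc (suc m) / 3
    t≤q : t ≤ q
    t≤q = 3*-cancel-≤ (ℕ.≤-trans 3t≤ (ℕ.≤-reflexive (trans (regroup m)
      (trans (cong (_+ 2) eq) (cong (_+ 2) (ℕ.*-comm q 3))))))
      where
      regroup : ∀ m → m + 4 ≡ suc (suc m) + 2
      regroup = ℕRing.solve-∀
    q≤t : q ≤ t
    q≤t = ℕ.*-cancelˡ-≤ 3 (ℕ.≤-trans (ℕ.≤-reflexive (trans (ℕ.*-comm 3 q) (sym eq))) ≤3t)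
  ... | suc r | eq | s≤s r<2 = begin
    + t                            ≡⟨ cong +_ (ℕ.≤-antisym t≤1+q 1+q≤t) ⟩
    + suc q                        ≡⟨ cong ℤ.-_ (ℤ.*-identityˡ ℤ.-[1+ q ]) ⟨
    ℤ.- (1ℤ ℤ.* ℤ.-[1+ q ])        ∎
    where
    open ≡-Reasoning
    q = suc (suc m) / 3
    t≤1+q : t ≤ suc q
    t≤1+q = 3*-cancel-≤ (ℕ.≤-trans 3t≤ (ℕ.≤-trans (ℕ.≤-reflexive (trans (regroup m) (cong (_+ 2) eq)))
      (ℕ.≤-trans (ℕ.+-monoˡ-≤ 2 (ℕ.+-monoˡ-≤ (q * 3) (ℕ.m≤n⇒m≤1+n r<2))) (ℕ.≤-reflexive (collect q)))))
      where
      regroup : ∀ m → m + 4 ≡ suc (suc m) + 2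
      regroup = ℕRing.solve-∀
      collect : ∀ q → 3 + q * 3 + 2 ≡ 3 * suc q + 2
      collect = ℕRing.solve-∀
    1+q≤t : suc q ≤ t
    1+q≤t = ℕ.*-cancelˡ-< 3 q t (ℕ.≤-trans (s≤s
      (ℕ.≤-trans (ℕ.≤-reflexive (ℕ.*-comm 3 q)) (ℕ.m≤n+m (q * 3) r)))
      (ℕ.≤-trans (ℕ.≤-reflexive (sym eq)) ≤3t))

  -- Edges as list entries, and the lower bound on the strength.

  module _ (G : Graph) where
    open Graph G

    endpoints : Edge → Vertex × Vertex
    endpoints e = src e , tgt e

    endpoints-injective : ∀ {e f} → endpoints e ≡ endpoints f → e ≡ f
    endpoints-injective {edge u v _ _} {edge .u .v _ _} refl = refl

    endpoints∈edgePairs : ∀ e → endpoints e ∈ edgePairs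
    endpoints∈edgePairs (edge u v u<v u~v) =
      ∈-filter⁺ (λ (u , v) → (u <? v) ×-dec adj? u v) (∈-cartesianProduct⁺ (∈-allFin u) (∈-allFin v))
        -- The proof fields of an edge are irrelevant, so usable proofs are recovered by deciding
        -- the two conditions again.
        (recompute (u <? v) u<v , recompute (adj? u v) u~v)

    edgePairs-unique : Unique edgePairs
    edgePairs-unique = filter⁺ (λ (u , v) → (u <? v) ×-dec adj? u v)
      (cartesianProduct⁺ (allFin⁺ order) (allFin⁺ order))

    edgeAt : Fin size → Edge
    edgeAt i with ∈-filter⁻ (λ (u , v) → (u <? v) ×-dec adj? u v)
                    {xs = cartesianProduct (allFin order) (allFin order)} (∈-lookup {xs = edgePairs} i)
    ... | _ , u<v , u~v =
      edge (proj₁ (List.lookup edgePairs i)) (proj₂ (List.lookup edgePairs i)) u<v u~v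

    edgeAt-injective : ∀ {i j} → edgeAt i ≡ edgeAt j → i ≡ j
    edgeAt-injective eq = lookup-injective edgePairs-unique (cong endpoints eq)

    -- All edge weights lie between 3 and `3 * s`, which leaves `3 * s ∸ 2` values, and distinct
    -- edges need distinct values.
    size+2≤3s : ∀ s → 1 ≤ s → HasEdgeIrregularWeighting G s → size + 2 ≤ 3 * s
    size+2≤3s s 1≤s (w , irr) =
      -- Positivity of `s` gives `2 ≤ 3 * s`, so the subtraction is not truncated.
      ℕ.m≤o∸n⇒m+n≤o size (ℕ.≤-trans (s≤s (s≤s z≤n)) (ℕ.*-monoʳ-≤ 3 1≤s)) (injective⇒≤ value-injective)
      where
      open IsEdgeIrregular irr
      weight : Fin size → ℕ
      weight i = edgeWeight G w (edgeAt i)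
      3≤weight : ∀ i → 3 ≤ weight i
      3≤weight i = ℕ.+-mono-≤ (ℕ.+-mono-≤ (positive _) (positive _)) (positive _)
      triple : ∀ s → s + s + s ≡ 3 * s
      triple = ℕRing.solve-∀
      weight≤3s : ∀ i → weight i ≤ 3 * s
      weight≤3s i = ℕ.≤-trans (ℕ.+-mono-≤ (ℕ.+-mono-≤ (bounded _) (bounded _)) (bounded _))
                            (ℕ.≤-reflexive (triple s))
      weight∸3< : ∀ i → weight i ∸ 3 < 3 * s ∸ 2
      weight∸3< i = ℕ.≤-trans (ℕ.≤-reflexive (sym (ℕ.+-∸-assoc 1 (3≤weight i))))
                                  (ℕ.∸-monoˡ-≤ 3 (s≤s (weight≤3s i)))
      value : Fin size → Fin (3 * s ∸ 2)
      value i = fromℕ< (weight∸3< i)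
      weight-injective : ∀ {i j} → weight i ≡ weight j → i ≡ j
      weight-injective {i} {j} eq with i Fin.≟ j
      ... | yes i≡j = i≡j
      ... | no  i≢j = contradiction eq (irregular (edgeAt i) (edgeAt j) (i≢j ∘ edgeAt-injective))
      value-injective : ∀ {i j} → value i ≡ value j → i ≡ j
      value-injective {i} {j} eq = weight-injective (ℕ.∸-cancelʳ-≡ (3≤weight i) (3≤weight j)
        (fromℕ<-injective _ _ (weight∸3< i) (weight∸3< j) eq))

  level≤5 : ∀ x → level x ≤ 5
  level≤5 = from-yes (all? λ x → level x ≤? 5)

  -- Ranking the edges by level sum.

  module Ranking (G : Graph) (c : Graph.Vertex G → Fin 12) where
    open Graph G

    index : Vertex × Vertex → ℕ
    index (u , v) = toℕ (combine u v)

    index-injective : ∀ {e f} → index e ≡ index f → e ≡ f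
    index-injective {u , v} {u′ , v′} eq =
      let u≡ , v≡ = combine-injective u v u′ v′ (toℕ-injective eq) in cong₂ _,_ u≡ v≡

    ℓ : Vertex × Vertex → ℕ
    ℓ = pairLevel G c

    -- Encodes the lexicographic order by level sum and then by `index`, which is below
    -- `order * order`. The second component only breaks ties, so that no two edges share a rank.
    key : Vertex × Vertex → ℕ
    key e = ℓ e * (order * order) + index e

    key-mono-< : ∀ {e f} → ℓ e < ℓ f → key e < key f
    key-mono-< {e@(u , v)} {f} ℓe<ℓf = begin-strict
      ℓ e * (order * order) + index e           <⟨ ℕ.+-monoʳ-< (ℓ e * (order * order)) (toℕ<n (combine u v)) ⟩
      ℓ e * (order * order) + order * order     ≡⟨ ℕ.+-comm (ℓ e * (order * order)) (order * order) ⟩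
      suc (ℓ e) * (order * order)               ≤⟨ ℕ.*-monoˡ-≤ (order * order) ℓe<ℓf ⟩
      ℓ f * (order * order)                     ≤⟨ ℕ.m≤m+n (ℓ f * (order * order)) (index f) ⟩
      key f                                     ∎
      where open ℕ.≤-Reasoning

    key-injective : ∀ {e f} → key e ≡ key f → e ≡ f
    key-injective {e} {f} eq with ℕ.<-cmp (ℓ e) (ℓ f)
    ... | tri< ℓe<ℓf _ _ = contradiction eq (ℕ.<⇒≢ (key-mono-< ℓe<ℓf))
    ... | tri> _ _ ℓe>ℓf = contradiction (sym eq) (ℕ.<⇒≢ (key-mono-< ℓe>ℓf))
    ... | tri≈ _ ℓe≡ℓf _ = index-injective (ℕ.+-cancelˡ-≡ (ℓ e * (order * order)) _ _
      (trans eq (cong (λ l → l * (order * order) + index f) (sym ℓe≡ℓf))))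

    rank : Vertex × Vertex → ℕ
    rank e = length (filter (λ f → key f ℕ.<? key e) edgePairs)

    rank-mono-< : ∀ {e f} → e ∈ edgePairs → key e < key f → rank e < rank f
    rank-mono-< {e} {f} e∈ e<f = length-filter-mono-< (λ g → key g ℕ.<? key e) (λ g → key g ℕ.<? key f)
      (λ g<e → ℕ.<-trans g<e e<f) e∈ e<f (ℕ.<-irrefl refl)

    rank-injective : ∀ {e f} → e ∈ edgePairs → f ∈ edgePairs → rank e ≡ rank f → e ≡ f
    rank-injective {e} {f} e∈ f∈ eq with ℕ.<-cmp (key e) (key f)
    ... | tri< e<f _ _ = contradiction eq (ℕ.<⇒≢ (rank-mono-< e∈ e<f))
    ... | tri≈ _ e≡f _ = key-injective e≡f
    ... | tri> _ _ e>f = contradiction (sym eq) (ℕ.<⇒≢ (rank-mono-< f∈ e>f))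

    -- All edges of level sum at most `j` precede `e`.
    #≤-lower : ∀ {e j} → j < ℓ e → #≤ G c j ≤ rank e
    #≤-lower {e} {j} j<ℓ = length-filter-mono-≤ (λ f → ℓ f ≤? j) (λ f → key f ℕ.<? key e)
      (λ ℓf≤j → key-mono-< (ℕ.≤-<-trans ℓf≤j j<ℓ)) edgePairs

    -- Every edge that precedes `e` has level sum at most `ℓ e`; the inequality is strict because
    -- `e` itself is counted on the right only.
    #≤-upper : ∀ {e} → e ∈ edgePairs → rank e < #≤ G c (ℓ e)
    #≤-upper {e} e∈ = length-filter-mono-< (λ f → key f ℕ.<? key e) (λ f → ℓ f ≤? ℓ e)
      (λ f<e → ℕ.≮⇒≥ λ ℓe<ℓf → ℕ.<-asym f<e (key-mono-< ℓe<ℓf)) e∈ ℕ.≤-refl (ℕ.<-irrefl refl)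

    rank<size : ∀ {e} → e ∈ edgePairs → rank e < size
    rank<size {e} e∈ = filter-notAll (λ f → key f ℕ.<? key e) edgePairs
      (Any.map (λ { refl → ℕ.<-irrefl refl }) e∈)

  -- The weighting obtained from balanced classes.

  module Labelling (G : Graph) (c : Graph.Vertex G → Fin 12) (s : ℕ)
    (lower : ∀ (j : Fin 10) → suc (toℕ j) * s ≤ 5 * #≤ G c (toℕ j))
    (upper : ∀ (j : Fin 10) → 5 * #≤ G c (toℕ j) + 3 ≤ (toℕ j + 5) * s)
    (size≤ : Graph.size G ≤ 3 * s + 1) where
    open Graph G
    open Ranking G c

    ω : Vertex → ℕ
    ω v = level (c v) * s / 5

    base : Vertex × Vertex → ℕ
    base (u , v) = ω u + ω v

    5ω≤ : ∀ v → 5 * ω v ≤ level (c v) * s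
    5ω≤ v = subst (_≤ level (c v) * s) (ℕ.*-comm (ω v) 5) (m/n*n≤m (level (c v) * s) 5)

    ≤5ω : ∀ v → level (c v) * s ≤ 5 * ω v + 4
    ≤5ω v = begin
      level (c v) * s                    ≡⟨ m≡m%n+[m/n]*n (level (c v) * s) 5 ⟩
      (level (c v) * s) % 5 + ω v * 5    ≤⟨ ℕ.+-monoˡ-≤ (ω v * 5) (ℕ.s≤s⁻¹ (m%n<n (level (c v) * s) 5)) ⟩
      4 + ω v * 5                        ≡⟨ regroup (ω v) ⟩
      5 * ω v + 4                        ∎
      where
      open ℕ.≤-Reasoning
      regroup : ∀ w → 4 + w * 5 ≡ 5 * w + 4
      regroup = ℕRing.solve-∀

    ω≤s : ∀ v → ω v ≤ s
    ω≤s v = ℕ.*-cancelˡ-≤ 5 (ℕ.≤-trans (5ω≤ v) (ℕ.*-monoˡ-≤ s (level≤5 (c v))))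

    5base≤ : ∀ e → 5 * base e ≤ ℓ e * s
    5base≤ (u , v) = begin
      5 * (ω u + ω v)                      ≡⟨ ℕ.*-distribˡ-+ 5 (ω u) (ω v) ⟩
      5 * ω u + 5 * ω v                    ≤⟨ ℕ.+-mono-≤ (5ω≤ u) (5ω≤ v) ⟩
      level (c u) * s + level (c v) * s    ≡⟨ ℕ.*-distribʳ-+ s (level (c u)) (level (c v)) ⟨
      ℓ (u , v) * s                        ∎
      where open ℕ.≤-Reasoning

    ≤5base : ∀ e → ℓ e * s ≤ 5 * base e + 8
    ≤5base (u , v) = begin
      ℓ (u , v) * s                        ≡⟨ ℕ.*-distribʳ-+ s (level (c u)) (level (c v)) ⟩
      level (c u) * s + level (c v) * s    ≤⟨ ℕ.+-mono-≤ (≤5ω u) (≤5ω v) ⟩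
      5 * ω u + 4 + (5 * ω v + 4)          ≡⟨ regroup (ω u) (ω v) ⟩
      5 * (ω u + ω v) + 8                  ∎
      where
      open ℕ.≤-Reasoning
      regroup : ∀ a b → 5 * a + 4 + (5 * b + 4) ≡ 5 * (a + b) + 8
      regroup = ℕRing.solve-∀

    ℓ≤10 : ∀ e → ℓ e ≤ 10
    ℓ≤10 (u , v) = ℕ.+-mono-≤ (level≤5 (c u)) (level≤5 (c v))

    lower′ : ∀ {j} → j < 10 → suc j * s ≤ 5 * #≤ G c j
    lower′ j<10 = subst (λ j → suc j * s ≤ 5 * #≤ G c j) (toℕ-fromℕ< j<10) (lower (fromℕ< j<10))

    upper′ : ∀ {j} → j < 10 → 5 * #≤ G c j + 3 ≤ (j + 5) * s
    upper′ j<10 = subst (λ j → 5 * #≤ G c j + 3 ≤ (j + 5) * s) (toℕ-fromℕ< j<10) (upper (fromℕ< j<10))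

    -- At level sum 0 both ends have weight 0. At level sum `suc j` the edge comes after all edges
    -- of level sum at most `j`, and `lower` says that there are enough of these.
    base≤rank : ∀ e → base e ≤ rank e
    base≤rank e = ℕ.*-cancelˡ-≤ 5 (ℕ.≤-trans (5base≤ e) (by-level (ℓ e) refl))
      where
      by-level : ∀ l → l ≡ ℓ e → l * s ≤ 5 * rank e
      by-level zero    _    = z≤n
      by-level (suc j) l≡ℓe = ℕ.≤-trans (lower′ (subst (_≤ 10) (sym l≡ℓe) (ℓ≤10 e)))
        (ℕ.*-monoʳ-≤ 5 (#≤-lower (ℕ.≤-reflexive l≡ℓe)))

    -- Level sum 10 forces level 5 at both ends, where the division by 5 is exact.
    top-level : ∀ u v → ¬ ℓ (u , v) < 10 → base (u , v) ≡ s + s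
    top-level u v ℓ≮10 = cong₂ _+_
      (top (c u) (c v) (ℕ.≮⇒≥ ℓ≮10))
      (top (c v) (c u) (ℕ.≤-trans (ℕ.≮⇒≥ ℓ≮10) (ℕ.≤-reflexive (ℕ.+-comm (level (c u)) (level (c v))))))
      where
      top : ∀ x y → 10 ≤ level x + level y → level x * s / 5 ≡ s
      top x y 10≤ = trans (cong (λ l → l * s / 5) (ℕ.≤-antisym (level≤5 x)
        (ℕ.+-cancelʳ-≤ 5 5 (level x) (ℕ.≤-trans 10≤ (ℕ.+-monoʳ-≤ (level x) (level≤5 y))))))
        (trans (cong (_/ 5) (ℕ.*-comm 5 s)) (m*n/n≡m s 5))

    -- Below level sum 10 the two floors in `base` lose at most 8, measured in fifths, and the
    -- strictness of `#≤-upper` gives back 5; this is the 3 in `upper`. At level sum 10 `base` is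
    -- `s + s`, and the bound on `size` suffices.
    rank≤base+s : ∀ {e} → e ∈ edgePairs → rank e ≤ base e + s
    rank≤base+s {e@(u , v)} e∈ with ℓ e ℕ.<? 10
    ... | yes ℓ<10 = ℕ.*-cancelˡ-≤ 5 (ℕ.+-cancelʳ-≤ 8 (5 * rank e) (5 * (base e + s)) (begin
      5 * rank e + 8           ≡⟨ next (rank e) ⟩
      5 * suc (rank e) + 3     ≤⟨ ℕ.+-monoˡ-≤ 3 (ℕ.*-monoʳ-≤ 5 (#≤-upper e∈)) ⟩
      5 * #≤ G c (ℓ e) + 3     ≤⟨ upper′ ℓ<10 ⟩
      (ℓ e + 5) * s            ≡⟨ ℕ.*-distribʳ-+ s (ℓ e) 5 ⟩
      ℓ e * s + 5 * s          ≤⟨ ℕ.+-monoˡ-≤ (5 * s) (≤5base e) ⟩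
      5 * base e + 8 + 5 * s   ≡⟨ regroup (base e) s ⟩
      5 * (base e + s) + 8     ∎))
      where
      open ℕ.≤-Reasoning
      next : ∀ r → 5 * r + 8 ≡ 5 * suc r + 3
      next = ℕRing.solve-∀
      regroup : ∀ b s → 5 * b + 8 + 5 * s ≡ 5 * (b + s) + 8
      regroup = ℕRing.solve-∀
    ... | no ℓ≮10 = ℕ.s≤s⁻¹ (begin
      suc (rank e)        ≤⟨ rank<size e∈ ⟩
      size                ≤⟨ size≤ ⟩
      3 * s + 1           ≡⟨ regroup s ⟩
      suc (s + s + s)     ≡⟨ cong (λ b → suc (b + s)) (top-level u v ℓ≮10) ⟨
      suc (base e + s)    ∎)
      where
      open ℕ.≤-Reasoning
      regroup : ∀ s → 3 * s + 1 ≡ suc (s + s + s)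
      regroup = ℕRing.solve-∀

    weighting : Weighting G
    weighting (inj₁ e) = suc (rank (endpoints G e) ∸ base (endpoints G e))
    weighting (inj₂ v) = suc (ω v)

    edgeWeight≡ : ∀ e → edgeWeight G weighting e ≡ 3 + rank (endpoints G e)
    edgeWeight≡ e = trans (regroup (r ∸ b) (ω (src e)) (ω (tgt e)))
      -- By `base≤rank` the truncated subtraction in the edge label is exact; the 3 comes from the
      -- three shifted labels.
      (cong (λ r → 3 + r) (ℕ.m∸n+n≡m (base≤rank (endpoints G e))))
      where
      r = rank (endpoints G e)
      b = base (endpoints G e)
      regroup : ∀ d x y → suc d + suc x + suc y ≡ 3 + (d + (x + y))
      regroup = ℕRing.solve-∀

    isEdgeIrregular : IsEdgeIrregular G (suc s) weighting
    isEdgeIrregular = record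
      { positive  = λ { (inj₁ _) → s≤s z≤n ; (inj₂ _) → s≤s z≤n }
      ; bounded   = λ { (inj₁ e) → s≤s (ℕ.m≤n+o⇒m∸n≤o (rank (endpoints G e)) (base (endpoints G e))
                                     (rank≤base+s (endpoints∈edgePairs G e)))
                      ; (inj₂ v) → s≤s (ω≤s v) }
      ; irregular = λ e f e≢f eq → e≢f (endpoints-injective G
                      (rank-injective (endpoints∈edgePairs G e) (endpoints∈edgePairs G f)
                        (ℕ.+-cancelˡ-≡ 3 _ _ (trans (sym (edgeWeight≡ e)) (trans eq (edgeWeight≡ f))))))
      }

  -- From balanced counts to the hypotheses of the labelling.

  lower-slack : ∀ j → 144 * suc (toℕ j) + 46 ≤ 15 * expected j
  lower-slack = from-yes (all? λ j → 144 * suc (toℕ j) + 46 ≤? 15 * expected j)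

  upper-slack : ∀ j → 15 * expected j + 46 ≤ 144 * (toℕ j + 5)
  upper-slack = from-yes (all? λ j → 15 * expected j + 46 ≤? 144 * (toℕ j + 5))

  -- Both bounds are multiplied by 432 = 3 · 144, which clears the denominators of `s` and of the
  -- expected count and turns `5 * N` into `15 * (144 * N)`. The deviation `3 * m` then costs 45
  -- times `m`; the slack of 46 leaves one further `m`, and `4350 ≤ m` makes it absorb the rounding
  -- terms.
  module _ (m s N : ℕ) (j : Fin 10) (4350≤m : 4350 ≤ m) where
    private
      p = expected j

    lower-bound : 3 * s ≤ m + 1 → m * p ≤ 144 * N + 3 * m → suc (toℕ j) * s ≤ 5 * N
    lower-bound 3s≤m+1 mp≤ = ℕ.*-cancelˡ-≤ 432
      (ℕ.+-cancelʳ-≤ (45 * m) (432 * (suc (toℕ j) * s)) (432 * (5 * N)) (begin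
      432 * (suc (toℕ j) * s) + 45 * m   ≡⟨ cong (_+ 45 * m) (r₁ (suc (toℕ j)) s) ⟩
      q * (3 * s) + 45 * m               ≤⟨ ℕ.+-monoˡ-≤ (45 * m) (ℕ.*-monoʳ-≤ q 3s≤m+1) ⟩
      q * (m + 1) + 45 * m               ≡⟨ r₂ q m ⟩
      (q + 45) * m + q                   ≤⟨ ℕ.+-monoʳ-≤ ((q + 45) * m) q≤m ⟩
      (q + 45) * m + m                   ≡⟨ r₃ q m ⟩
      (q + 46) * m                       ≤⟨ ℕ.*-monoˡ-≤ m (lower-slack j) ⟩
      15 * p * m                         ≡⟨ r₄ p m ⟩
      15 * (m * p)                       ≤⟨ ℕ.*-monoʳ-≤ 15 mp≤ ⟩
      15 * (144 * N + 3 * m)             ≡⟨ r₅ N m ⟩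
      432 * (5 * N) + 45 * m             ∎))
      where
      open ℕ.≤-Reasoning
      q = 144 * suc (toℕ j)
      q≤m : q ≤ m
      q≤m = ℕ.≤-trans (ℕ.*-monoʳ-≤ 144 (toℕ<n j)) (ℕ.≤-trans (from-yes (1440 ≤? 4350)) 4350≤m)
      r₁ : ∀ a s → 432 * (a * s) ≡ 144 * a * (3 * s)
      r₁ = ℕRing.solve-∀
      r₂ : ∀ q m → q * (m + 1) + 45 * m ≡ (q + 45) * m + q
      r₂ = ℕRing.solve-∀
      r₃ : ∀ q m → (q + 45) * m + m ≡ (q + 46) * m
      r₃ = ℕRing.solve-∀
      r₄ : ∀ p m → 15 * p * m ≡ 15 * (m * p)
      r₄ = ℕRing.solve-∀
      r₅ : ∀ N m → 15 * (144 * N + 3 * m) ≡ 432 * (5 * N) + 45 * m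
      r₅ = ℕRing.solve-∀

    upper-bound : m ≤ 3 * s + 1 → 144 * N ≤ m * p + 3 * m → 5 * N + 3 ≤ (toℕ j + 5) * s
    upper-bound m≤3s+1 N≤ = ℕ.*-cancelˡ-≤ 432
      (ℕ.+-cancelʳ-≤ q (432 * (5 * N + 3)) (432 * ((toℕ j + 5) * s)) (begin
      432 * (5 * N + 3) + q                  ≡⟨ r₁ N q ⟩
      -- 1296 = 432 · 3 is the contribution of the rounding term 3.
      15 * (144 * N) + (1296 + q)            ≤⟨ ℕ.+-mono-≤ (ℕ.*-monoʳ-≤ 15 N≤) 1296+q≤m ⟩
      15 * (m * p + 3 * m) + m               ≡⟨ r₂ m p ⟩
      (15 * p + 46) * m                      ≤⟨ ℕ.*-monoˡ-≤ m (upper-slack j) ⟩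
      q * m                                  ≤⟨ ℕ.*-monoʳ-≤ q m≤3s+1 ⟩
      q * (3 * s + 1)                        ≡⟨ r₃ (toℕ j + 5) s ⟩
      432 * ((toℕ j + 5) * s) + q            ∎))
      where
      open ℕ.≤-Reasoning
      q = 144 * (toℕ j + 5)
      1296+q≤m : 1296 + q ≤ m
      1296+q≤m = ℕ.≤-trans (ℕ.+-monoʳ-≤ 1296 (ℕ.*-monoʳ-≤ 144 (ℕ.+-monoˡ-≤ 5 (ℕ.<⇒≤ (toℕ<n j)))))
        (ℕ.≤-trans (from-yes (1296 + 144 * 15 ≤? 4350)) 4350≤m)
      r₁ : ∀ N q → 432 * (5 * N + 3) + q ≡ 15 * (144 * N) + (1296 + q)
      r₁ = ℕRing.solve-∀
      r₂ : ∀ m p → 15 * (m * p + 3 * m) + m ≡ (15 * p + 46) * m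
      r₂ = ℕRing.solve-∀
      r₃ : ∀ a s → 144 * a * (3 * s + 1) ≡ 432 * (a * s) + 144 * a
      r₃ = ℕRing.solve-∀

  -- Existence of the weighting, and the theorem.

  module _ (G : Graph) where
    open Graph G

    -- Handshake lemma: twice the number of edges is a sum of terms, each bounded by the maximum
    -- degree.
    maxDegree≡0⇒size≡0 : maxDegree ≡ 0 → size ≡ 0
    maxDegree≡0⇒size≡0 Δ≡0 = ℕ.n≤0⇒n≡0 (ℕ.*-cancelˡ-≤ 2 (ℤ.drop‿+≤+ (begin
      + (2 * size)         ≡⟨ ℤ.pos-* 2 size ⟩
      + 2 ℤ.* + size       ≡⟨ cong (+ 2 ℤ.*_) (size≡∑∑ G) ⟩
      + 2 ℤ.* ∑∑ (B G)     ≡⟨ Dev.∑d (B G) (0≤B G) (B-idem G) (B-upper G) ⟨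
      ∑∑ (λ v u → B G v u ℤ.+ B G u v)     ≤⟨ ∑-mono (incidences≤maxDegree G) ⟩
      ∑[ v < order ] (+ maxDegree)         ≡⟨ ∑-zero {order} (λ _ → cong +_ Δ≡0) ⟩
      0ℤ                   ∎)))
      where open ℤ.≤-Reasoning

    no-edges : size ≡ 0 → ¬ Edge
    no-edges m≡0 e with edgePairs | m≡0 | endpoints∈edgePairs G e
    ... | [] | _ | ()

    -- The variance bound assumed maximum degree at least 1, which also yields the 4350 edges needed
    -- for rounding. In the other case there are no edges, and any labels in range will do.
    ∃-weighting : 4350 * maxDegree ≤ size → HasEdgeIrregularWeighting G (⌈/3⌉ size)
    ∃-weighting 4350Δ≤m = by-degree (maxDegree ℕ.≟ 0)
      where
      from-balanced : 4350 ≤ size → ∃[ c ] Balanced G c → HasEdgeIrregularWeighting G (⌈/3⌉ size)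
      from-balanced 4350≤m (c , balanced) = L.weighting , L.isEdgeIrregular
        where
        module L = Labelling G c ((size + 1) / 3)
          (λ j → lower-bound size ((size + 1) / 3) (#≤ G c (toℕ j)) j 4350≤m
                 (3s≤m+1 size) (proj₁ (balanced j)))
          (λ j → upper-bound size ((size + 1) / 3) (#≤ G c (toℕ j)) j 4350≤m
                 (m≤3s+1 size) (proj₂ (balanced j)))
          (m≤3s+1 size)
      by-degree : Dec (maxDegree ≡ 0) → HasEdgeIrregularWeighting G (⌈/3⌉ size)
      by-degree (yes Δ≡0) = (λ _ → 1) , record
        { positive  = λ _ → ℕ.≤-refl
        ; bounded   = λ _ → s≤s z≤n
        ; irregular = λ e → contradiction e (no-edges (maxDegree≡0⇒size≡0 Δ≡0))
        }
      by-degree (no Δ≢0) = from-balanced 4350≤m (∃-balanced G 1≤Δ 4350Δ≤m)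
        where
        1≤Δ : 1 ≤ maxDegree
        1≤Δ = ℕ.n≢0⇒n>0 Δ≢0
        4350≤m : 4350 ≤ size
        4350≤m = ℕ.≤-trans (ℕ.m≤m*n 4350 maxDegree {{ℕ.>-nonZero 1≤Δ}}) 4350Δ≤m

  module _ (G : Graph) where
    open Graph G renaming (size to m)

    3t≤m+4 : 3 * ⌈/3⌉ m ≤ m + 4
    3t≤m+4 = begin
      3 * ⌈/3⌉ m             ≡⟨ ℕ.*-suc 3 ((m + 1) / 3) ⟩
      3 + 3 * ((m + 1) / 3)  ≤⟨ ℕ.+-monoʳ-≤ 3 (3s≤m+1 m) ⟩
      3 + (m + 1)            ≡⟨ regroup m ⟩
      m + 4                  ∎
      where
      open ℕ.≤-Reasoning
      regroup : ∀ m → 3 + (m + 1) ≡ m + 4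
      regroup = ℕRing.solve-∀

    m+2≤3t : m + 2 ≤ 3 * ⌈/3⌉ m
    m+2≤3t = begin
      m + 2                      ≤⟨ ℕ.+-monoˡ-≤ 2 (m≤3s+1 m) ⟩
      3 * ((m + 1) / 3) + 1 + 2  ≡⟨ regroup ((m + 1) / 3) ⟩
      3 * ⌈/3⌉ m                 ∎
      where
      open ℕ.≤-Reasoning
      regroup : ∀ s → 3 * s + 1 + 2 ≡ 3 * suc s
      regroup = ℕRing.solve-∀

    isTes-⌈/3⌉ : 4350 * maxDegree ≤ m → IsTes G (⌈/3⌉ m)
    isTes-⌈/3⌉ 4350Δ≤m = record
      { positive = s≤s z≤n
      ; attained = ∃-weighting G 4350Δ≤m
      -- The lower bound gives `m + 2 ≤ 3 * s`, and rounding up makes `3 * ⌈/3⌉ m` at most 2 larger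
      -- than `m + 2`; a slack of 2 disappears on division by 3.
      ; least    = λ s 1≤s weighted → 3*-cancel-≤ (begin
          3 * ⌈/3⌉ m  ≤⟨ 3t≤m+4 ⟩
          m + 4       ≡⟨ ℕ.+-assoc m 2 2 ⟨
          m + 2 + 2   ≤⟨ ℕ.+-monoˡ-≤ 2 (size+2≤3s G s 1≤s weighted) ⟩
          3 * s + 2   ∎)
      }
      where open ℕ.≤-Reasoning

    ⌈/3⌉≡ceiling : + ⌈/3⌉ m ≡ ℚ.ceiling ((+ (m + 2)) ℚ./ 3)
    ⌈/3⌉≡ceiling = ceiling-unique m (⌈/3⌉ m) 3t≤m+4 m+2≤3t

    4350Δ≤m : (+ maxDegree) ℚ./ 1 ℚ.≤ (+ m) ℚ./ 4350 → 4350 * maxDegree ≤ m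
    4350Δ≤m Δ≤m/4350 = subst₂ _≤_ (ℕ.*-comm maxDegree 4350) (ℕ.*-identityʳ m)
      (ℤ.drop‿+≤+ (subst₂ ℤ._≤_ (sym (ℤ.pos-* maxDegree 4350)) (sym (ℤ.pos-* m 1))
        (ℚ.drop-*≤* Δ≤m/4350)))

open import Data.Nat using (_+_)
open import Data.Rational.Unnormalised using (_/_; _≤_; ceiling)

theorem4 : (G : Graph) → let m = Graph.size G in
    (+ Graph.maxDegree G) / 1 ≤ (+ m) / 4350 →
    ∃[ t ] (IsTes G t × + t ≡ ceiling ((+ (m + 2)) / 3))
theorem4 G Δ≤m/4350 =
  ⌈/3⌉ (Graph.size G) , isTes-⌈/3⌉ G (4350Δ≤m G Δ≤m/4350) , ⌈/3⌉≡ceiling G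
  where open Labellings
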